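{- The generating function of the Stern polynomials satisfies $$\sum_{n=0}^{\infty}B_n(t)x^{n}=x\prod_{k=0}^{\infty}\bigl(1+tx^{2^{k}}+x^{2^{k+1}}\bigr)$$ as formal power series in $x$ with coefficients in $\mathbb{Z}[t]$; moreover, for every real $t$ and every real $x$ with $|x|<1$, both the series and the infinite product converge and are equal.
   Context: The Stern polynomials $B_n(t)\in\mathbb{Z}[t]$, $n\ge 0$, are defined by $B_0(t)=0$, $B_1(t)=1$, $B_{2n}(t)=tB_n(t)$ and $B_{2n+1}(t)=B_n(t)+B_{n+1}(t)$ for $n\ge 1$. -}

module Defs where

open import Algebra.Bundles using (RawSemiring)
import Algebra.Definitions.RawSemiring as RawSemiringOps
open import Data.Fin.Base using (toℕ)
open import Data.Integer.Base as ℤ using (ℤ; 0ℤ; 1ℤ)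
open import Data.List.Base using (List; []; _∷_; map)
open import Data.Nat.Base as ℕ using (ℕ; zero; suc; z≤n; s≤s)
import Data.Nat.DivMod as ℕ
import Data.Nat.Divisibility as ℕ
import Data.Nat.Properties as ℕ
open import Data.Product.Base using (∃; ∃₂; _×_; _,_; proj₁; proj₂)
open import Data.Rational.Base as ℚ using (ℚ; 0ℚ; 1ℚ; ½)
import Data.Rational.Properties as ℚ
open import Data.Rational.Solver using (module +-*-Solver)
open import Data.Sum.Base using (inj₁; inj₂)
open import Level using (0ℓ)
open import Relation.Binary.PropositionalEquality

open ℚ.≤-Reasoning
open +-*-Solver using (solve; _:=_; _:+_; _:*_; _:-_; :-_)

module _ {c ℓ} (R : RawSemiring c ℓ) where
  open RawSemiring R
  open RawSemiringOps R using (sum; product; _^_)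

  partialSum : (ℕ → Carrier) → ℕ → Carrier
  partialSum a n = sum {n} (λ i → a (toℕ i))

  partialProduct : (ℕ → Carrier) → ℕ → Carrier
  partialProduct a n = product {n} (λ i → a (toℕ i))

  factor : Carrier → Carrier → ℕ → Carrier
  factor t x k = 1# + t * x ^ (2 ℕ.^ k) + x ^ (2 ℕ.^ suc k)

-- ℤ[t] as coefficient lists, constant term first.  Trailing zeros are allowed,
-- so equality of polynomials is _≈ₚ_ rather than _≡_.

Poly : Set
Poly = List ℤ

coeff : Poly → ℕ → ℤ
coeff []      _       = 0ℤ
coeff (a ∷ p) zero    = a
coeff (a ∷ p) (suc i) = coeff p i

infix  4 _≈ₚ_
infixl 6 _+ₚ_
infixl 7 _*ₚ_

_≈ₚ_ : Poly → Poly → Set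
p ≈ₚ q = ∀ i → coeff p i ≡ coeff q i

_+ₚ_ : Poly → Poly → Poly
[]      +ₚ q       = q
(a ∷ p) +ₚ []      = a ∷ p
(a ∷ p) +ₚ (b ∷ q) = (a ℤ.+ b) ∷ (p +ₚ q)

_*ₚ_ : Poly → Poly → Poly
[]      *ₚ q = []
(a ∷ p) *ₚ q = map (a ℤ.*_) q +ₚ (0ℤ ∷ (p *ₚ q))

0ₚ 1ₚ tₚ : Poly
0ₚ = []
1ₚ = 1ℤ ∷ []
tₚ = 0ℤ ∷ 1ℤ ∷ []

polyRawSemiring : RawSemiring 0ℓ 0ℓ
polyRawSemiring = record
  { Carrier = Poly ; _≈_ = _≈ₚ_ ; _+_ = _+ₚ_ ; _*_ = _*ₚ_ ; 0# = 0ₚ ; 1# = 1ₚ }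

-- The first argument bounds the recursion depth; n itself always
-- suffices, which is what stern-even and stern-odd below confirm.

private
  sternAux : ℕ → ℕ → Poly
  sternAux _       0 = 0ₚ
  sternAux _       1 = 1ₚ
  sternAux zero    (suc (suc _)) = 0ₚ
  sternAux (suc d) n@(suc (suc _)) with n ℕ.% 2
  ... | zero  = tₚ *ₚ sternAux d (n ℕ./ 2)
  ... | suc _ = sternAux d (n ℕ./ 2) +ₚ sternAux d (suc (n ℕ./ 2))

stern : ℕ → Poly
stern n = sternAux n n

private
  half-bound : ∀ {d} k → suc (suc k) ℕ.≤ suc d → suc (suc k) ℕ./ 2 ℕ.≤ d
  half-bound k le = ℕ.≤-pred (ℕ.≤-trans (ℕ.m/n<m (suc (suc k)) 2 (s≤s (s≤s z≤n))) le)

  suc-half-bound : ∀ {d r} k → suc (suc k) ℕ.≤ suc d → suc (suc k) ℕ.% 2 ≡ suc r →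
                   suc (suc (suc k) ℕ./ 2) ℕ.≤ d
  suc-half-bound zero          le ()
  suc-half-bound {d} (suc k) (s≤s le) _ = ℕ.≤-trans
    (subst (λ h → suc h ℕ.≤ suc (suc k)) (sym (ℕ.+-distrib-/-∣ˡ {2} (suc k) (ℕ.∣-refl)))
      (s≤s (ℕ.m/n<m (suc k) 2 (s≤s (s≤s z≤n)))))
    le

  sternAux-stable : ∀ d e n → n ℕ.≤ d → n ℕ.≤ e → sternAux d n ≡ sternAux e n
  sternAux-stable d       e       0 _ _ = refl
  sternAux-stable d       e       1 _ _ = refl
  sternAux-stable (suc d) (suc e) n@(suc (suc k)) n≤d n≤e with n ℕ.% 2 in eq
  ... | zero  = cong (tₚ *ₚ_) (sternAux-stable d e _ (half-bound k n≤d) (half-bound k n≤e))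
  ... | suc _ = cong₂ _+ₚ_
    (sternAux-stable d e _ (half-bound k n≤d) (half-bound k n≤e))
    (sternAux-stable d e _ (suc-half-bound k n≤d eq) (suc-half-bound k n≤e eq))

  unfold-even : ∀ n → 2 ℕ.≤ n → n ℕ.% 2 ≡ 0 → stern n ≡ tₚ *ₚ stern (n ℕ./ 2)
  unfold-even (suc (suc k)) _ even with suc (suc k) ℕ.% 2
  unfold-even (suc (suc k)) _ refl | zero =
    cong (tₚ *ₚ_) (sternAux-stable _ _ _ (half-bound k ℕ.≤-refl) ℕ.≤-refl)
  unfold-even (suc zero) (s≤s ())

  unfold-odd : ∀ n → 2 ℕ.≤ n → n ℕ.% 2 ≡ 1 →
               stern n ≡ stern (n ℕ./ 2) +ₚ stern (suc (n ℕ./ 2))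
  unfold-odd (suc (suc k)) _ odd with suc (suc k) ℕ.% 2 in eq
  unfold-odd (suc (suc k)) _ refl | suc _ = cong₂ _+ₚ_
    (sternAux-stable _ _ _ (half-bound k ℕ.≤-refl) ℕ.≤-refl)
    (sternAux-stable _ _ _ (suc-half-bound k ℕ.≤-refl eq) ℕ.≤-refl)
  unfold-odd (suc zero) (s≤s ())

stern-0 : stern 0 ≡ 0ₚ
stern-0 = refl

stern-1 : stern 1 ≡ 1ₚ
stern-1 = refl

stern-even : ∀ n → 1 ℕ.≤ n → stern (2 ℕ.* n) ≡ tₚ *ₚ stern n
stern-even n 1≤n = trans
  (unfold-even (2 ℕ.* n) (ℕ.*-monoʳ-≤ 2 1≤n)
    (trans (cong (ℕ._% 2) (ℕ.*-comm 2 n)) (ℕ.m*n%n≡0 n 2)))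
  (cong (λ m → tₚ *ₚ stern m)
    (trans (cong (ℕ._/ 2) (ℕ.*-comm 2 n)) (ℕ.m*n/n≡m n 2)))

stern-odd : ∀ n → 1 ℕ.≤ n → stern (2 ℕ.* n ℕ.+ 1) ≡ stern n +ₚ stern (n ℕ.+ 1)
stern-odd n 1≤n = trans
  (unfold-odd (2 ℕ.* n ℕ.+ 1)
    (ℕ.≤-trans (ℕ.*-monoʳ-≤ 2 1≤n) (ℕ.m≤m+n _ 1))
    (trans (cong (ℕ._% 2) comm) (ℕ.[m+kn]%n≡m%n 1 n 2)))
  (cong₂ (λ m o → stern m +ₚ stern o) half (trans (cong suc half) (ℕ.+-comm 1 n)))
  where
  comm : 2 ℕ.* n ℕ.+ 1 ≡ 1 ℕ.+ n ℕ.* 2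
  comm = trans (ℕ.+-comm (2 ℕ.* n) 1) (cong suc (ℕ.*-comm 2 n))
  half : (2 ℕ.* n ℕ.+ 1) ℕ./ 2 ≡ n
  half = trans (cong (ℕ._/ 2) comm)
    (trans (ℕ.+-distrib-/-∣ʳ 1 {n ℕ.* 2} (ℕ.divides n refl)) (ℕ.m*n/n≡m n 2))

-- ℤ[t][[x]]: f stands for ∑ₙ f(n) xⁿ.

Series : Set
Series = ℕ → Poly

infix  4 _≈ₛ_
infixl 6 _+ₛ_
infixl 7 _*ₛ_

_≈ₛ_ : Series → Series → Set
f ≈ₛ g = ∀ n → f n ≈ₚ g n

_+ₛ_ : Series → Series → Series
(f +ₛ g) n = f n +ₚ g n

_*ₛ_ : Series → Series → Series
(f *ₛ g) n = partialSum polyRawSemiring (λ i → f i *ₚ g (n ℕ.∸ i)) (suc n)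

constₛ : Poly → Series
constₛ p zero    = p
constₛ p (suc _) = 0ₚ

xₛ : Series
xₛ 1 = 1ₚ
xₛ _ = 0ₚ

seriesRawSemiring : RawSemiring 0ℓ 0ℓ
seriesRawSemiring = record
  { Carrier = Series ; _≈_ = _≈ₛ_ ; _+_ = _+ₛ_ ; _*_ = _*ₛ_
  ; 0# = constₛ 0ₚ ; 1# = constₛ 1ₚ }

-- Convergence in the x-adic topology: every coefficient of the partial
-- products is eventually constant.

HasProductₛ : (ℕ → Series) → Series → Set
HasProductₛ a f =
  ∀ n → ∃ λ N → ∀ K → N ℕ.≤ K → partialProduct seriesRawSemiring a K n ≈ₚ f n

-- The reals as Cauchy sequences of rationals (with moduli, as in
-- constructive analysis); equality of reals is _≃_ below.

record ℝ : Set where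
  constructor mkℝ
  field
    seq    : ℕ → ℚ
    cauchy : ∀ ε → 0ℚ ℚ.< ε →
             ∃ λ N → ∀ m n → N ℕ.≤ m → N ℕ.≤ n → ℚ.∣ seq m ℚ.- seq n ∣ ℚ.< ε

open ℝ public

infix  4 _≃_ _<ᵣ_
infixl 6 _+ᵣ_ _-ᵣ_
infixl 7 _*ᵣ_
infix  8 -ᵣ_

_≃_ : ℝ → ℝ → Set
x ≃ y = ∀ ε → 0ℚ ℚ.< ε → ∃ λ N → ∀ n → N ℕ.≤ n → ℚ.∣ seq x n ℚ.- seq y n ∣ ℚ.< ε

-- Termwise < would not be invariant under _≃_: a uniform gap is needed.

_<ᵣ_ : ℝ → ℝ → Set
x <ᵣ y = ∃ λ δ → 0ℚ ℚ.< δ × ∃ λ N → ∀ n → N ℕ.≤ n → seq x n ℚ.+ δ ℚ.≤ seq y n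

private
  half-pos : ∀ {ε} → 0ℚ ℚ.< ε → 0ℚ ℚ.< ½ ℚ.* ε
  half-pos {ε} 0<ε = subst (ℚ._< ½ ℚ.* ε) (ℚ.*-zeroʳ ½) (ℚ.*-monoʳ-<-pos ½ 0<ε)

  half+half : ∀ ε → ½ ℚ.* ε ℚ.+ ½ ℚ.* ε ≡ ε
  half+half ε = trans (sym (ℚ.*-distribʳ-+ ε ½ ½)) (ℚ.*-identityˡ ε)

  abs-diff : ∀ p q → ℚ.∣ ℚ.∣ p ∣ ℚ.- ℚ.∣ q ∣ ∣ ℚ.≤ ℚ.∣ p ℚ.- q ∣
  abs-diff p q with ℚ.∣p∣≡p∨∣p∣≡-p (ℚ.∣ p ∣ ℚ.- ℚ.∣ q ∣)
  ... | inj₁ eq = subst (ℚ._≤ ℚ.∣ p ℚ.- q ∣) (sym eq) (oneSided p q)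
    where
    oneSided : ∀ p q → ℚ.∣ p ∣ ℚ.- ℚ.∣ q ∣ ℚ.≤ ℚ.∣ p ℚ.- q ∣
    oneSided p q = begin
      ℚ.∣ p ∣ ℚ.- ℚ.∣ q ∣
        ≡⟨ cong (λ r → ℚ.∣ r ∣ ℚ.- ℚ.∣ q ∣)
             (solve 2 (λ p q → p := (p :- q) :+ q) refl p q) ⟩
      ℚ.∣ (p ℚ.- q) ℚ.+ q ∣ ℚ.- ℚ.∣ q ∣
        ≤⟨ ℚ.+-monoˡ-≤ (ℚ.- ℚ.∣ q ∣) (ℚ.∣p+q∣≤∣p∣+∣q∣ (p ℚ.- q) q) ⟩
      (ℚ.∣ p ℚ.- q ∣ ℚ.+ ℚ.∣ q ∣) ℚ.- ℚ.∣ q ∣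
        ≡⟨ solve 2 (λ a b → (a :+ b) :- b := a) refl ℚ.∣ p ℚ.- q ∣ ℚ.∣ q ∣ ⟩
      ℚ.∣ p ℚ.- q ∣ ∎
  ... | inj₂ eq = begin
      ℚ.∣ ℚ.∣ p ∣ ℚ.- ℚ.∣ q ∣ ∣
        ≡⟨ eq ⟩
      ℚ.- (ℚ.∣ p ∣ ℚ.- ℚ.∣ q ∣)
        ≡⟨ solve 2 (λ a b → :- (a :- b) := b :- a) refl ℚ.∣ p ∣ ℚ.∣ q ∣ ⟩
      ℚ.∣ q ∣ ℚ.- ℚ.∣ p ∣
        ≡⟨ cong (λ r → ℚ.∣ r ∣ ℚ.- ℚ.∣ p ∣)
             (solve 2 (λ p q → q := (q :- p) :+ p) refl p q) ⟩
      ℚ.∣ (q ℚ.- p) ℚ.+ p ∣ ℚ.- ℚ.∣ p ∣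
        ≤⟨ ℚ.+-monoˡ-≤ (ℚ.- ℚ.∣ p ∣) (ℚ.∣p+q∣≤∣p∣+∣q∣ (q ℚ.- p) p) ⟩
      (ℚ.∣ q ℚ.- p ∣ ℚ.+ ℚ.∣ p ∣) ℚ.- ℚ.∣ p ∣
        ≡⟨ solve 2 (λ a b → (a :+ b) :- b := a) refl ℚ.∣ q ℚ.- p ∣ ℚ.∣ p ∣ ⟩
      ℚ.∣ q ℚ.- p ∣
        ≡⟨ cong ℚ.∣_∣ (solve 2 (λ p q → q :- p := :- (p :- q)) refl p q) ⟩
      ℚ.∣ ℚ.- (p ℚ.- q) ∣
        ≡⟨ ℚ.∣-p∣≡∣p∣ (p ℚ.- q) ⟩
      ℚ.∣ p ℚ.- q ∣ ∎

  bounded : ∀ x → ∃₂ λ A N → 0ℚ ℚ.< A × (∀ n → N ℕ.≤ n → ℚ.∣ seq x n ∣ ℚ.≤ A)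
  bounded x with cauchy x 1ℚ (ℚ.positive⁻¹ 1ℚ)
  ... | N , close = 1ℚ ℚ.+ ℚ.∣ seq x N ∣ , N , pos , bound
    where
    pos : 0ℚ ℚ.< 1ℚ ℚ.+ ℚ.∣ seq x N ∣
    pos = ℚ.+-mono-<-≤ {0ℚ} {1ℚ} {0ℚ} (ℚ.positive⁻¹ 1ℚ) (ℚ.0≤∣p∣ (seq x N))
    bound : ∀ n → N ℕ.≤ n → ℚ.∣ seq x n ∣ ℚ.≤ 1ℚ ℚ.+ ℚ.∣ seq x N ∣
    bound n N≤n = begin
      ℚ.∣ seq x n ∣
        ≡⟨ cong ℚ.∣_∣ (solve 2 (λ p q → p := (p :- q) :+ q) refl (seq x n) (seq x N)) ⟩
      ℚ.∣ (seq x n ℚ.- seq x N) ℚ.+ seq x N ∣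
        ≤⟨ ℚ.∣p+q∣≤∣p∣+∣q∣ (seq x n ℚ.- seq x N) (seq x N) ⟩
      ℚ.∣ seq x n ℚ.- seq x N ∣ ℚ.+ ℚ.∣ seq x N ∣
        ≤⟨ ℚ.+-monoˡ-≤ ℚ.∣ seq x N ∣ (ℚ.<⇒≤ (close n N N≤n ℕ.≤-refl)) ⟩
      1ℚ ℚ.+ ℚ.∣ seq x N ∣ ∎

fromℚ : ℚ → ℝ
fromℚ q = mkℝ (λ _ → q) λ ε 0<ε →
  0 , λ _ _ _ _ → subst (ℚ._< ε) (cong ℚ.∣_∣ (sym (ℚ.+-inverseʳ q))) 0<ε

fromℤ : ℤ → ℝ
fromℤ a = fromℚ (a ℚ./ 1)

0ᵣ 1ᵣ : ℝ
0ᵣ = fromℚ 0ℚ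
1ᵣ = fromℚ 1ℚ

_+ᵣ_ : ℝ → ℝ → ℝ
x +ᵣ y = mkℝ (λ n → seq x n ℚ.+ seq y n) cauchy-+
  where
  -- Abstract for type-checking speed only; seq still computes.
  abstract
    cauchy-+ : ∀ ε → 0ℚ ℚ.< ε → ∃ λ N → ∀ m n → N ℕ.≤ m → N ℕ.≤ n →
               ℚ.∣ (seq x m ℚ.+ seq y m) ℚ.- (seq x n ℚ.+ seq y n) ∣ ℚ.< ε
    cauchy-+ ε 0<ε with cauchy x (½ ℚ.* ε) (half-pos 0<ε) | cauchy y (½ ℚ.* ε) (half-pos 0<ε)
    ... | N₁ , close₁ | N₂ , close₂ = N₁ ℕ.⊔ N₂ , λ m n N≤m N≤n → begin-strict
        ℚ.∣ (seq x m ℚ.+ seq y m) ℚ.- (seq x n ℚ.+ seq y n) ∣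
          ≡⟨ cong ℚ.∣_∣ (solve 4 (λ a b c d → (a :+ b) :- (c :+ d) := (a :- c) :+ (b :- d))
               refl (seq x m) (seq y m) (seq x n) (seq y n)) ⟩
        ℚ.∣ (seq x m ℚ.- seq x n) ℚ.+ (seq y m ℚ.- seq y n) ∣
          ≤⟨ ℚ.∣p+q∣≤∣p∣+∣q∣ (seq x m ℚ.- seq x n) (seq y m ℚ.- seq y n) ⟩
        ℚ.∣ seq x m ℚ.- seq x n ∣ ℚ.+ ℚ.∣ seq y m ℚ.- seq y n ∣
          <⟨ ℚ.+-mono-<
               (close₁ m n (ℕ.m⊔n≤o⇒m≤o N₁ N₂ N≤m) (ℕ.m⊔n≤o⇒m≤o N₁ N₂ N≤n))
               (close₂ m n (ℕ.m⊔n≤o⇒n≤o N₁ N₂ N≤m) (ℕ.m⊔n≤o⇒n≤o N₁ N₂ N≤n)) ⟩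
        ½ ℚ.* ε ℚ.+ ½ ℚ.* ε
          ≡⟨ half+half ε ⟩
        ε ∎

-ᵣ_ : ℝ → ℝ
-ᵣ x = mkℝ (λ n → ℚ.- seq x n) λ ε 0<ε →
  proj₁ (cauchy x ε 0<ε) , λ m n N≤m N≤n →
    subst (ℚ._< ε)
      (trans (sym (ℚ.∣-p∣≡∣p∣ (seq x m ℚ.- seq x n)))
        (cong ℚ.∣_∣ (solve 2 (λ a b → :- (a :- b) := :- a :- :- b) refl (seq x m) (seq x n))))
      (proj₂ (cauchy x ε 0<ε) m n N≤m N≤n)

_-ᵣ_ : ℝ → ℝ → ℝ
x -ᵣ y = x +ᵣ -ᵣ y

private
  scale : ∀ a b {C δ} → 0ℚ ℚ.< C → ℚ.∣ a ∣ ℚ.≤ C → ℚ.∣ b ∣ ℚ.< δ → ℚ.∣ a ℚ.* b ∣ ℚ.< C ℚ.* δ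
  scale a b {C} {δ} 0<C a≤C b<δ = begin-strict
    ℚ.∣ a ℚ.* b ∣       ≡⟨ ℚ.∣p*q∣≡∣p∣*∣q∣ a b ⟩
    ℚ.∣ a ∣ ℚ.* ℚ.∣ b ∣ ≤⟨ ℚ.*-monoʳ-≤-nonNeg ℚ.∣ b ∣ {{ℚ.∣-∣-nonNeg b}} a≤C ⟩
    C ℚ.* ℚ.∣ b ∣       <⟨ ℚ.*-monoʳ-<-pos C {{ℚ.positive 0<C}} b<δ ⟩
    C ℚ.* δ             ∎

  product-close : ∀ a b c d {A B δ} → 0ℚ ℚ.< A → 0ℚ ℚ.< B → ℚ.∣ a ∣ ℚ.≤ A → ℚ.∣ d ∣ ℚ.≤ B →
                  ℚ.∣ a ℚ.- c ∣ ℚ.< δ → ℚ.∣ b ℚ.- d ∣ ℚ.< δ →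
                  ℚ.∣ a ℚ.* b ℚ.- c ℚ.* d ∣ ℚ.< (A ℚ.+ B) ℚ.* δ
  product-close a b c d {A} {B} {δ} 0<A 0<B a≤A d≤B ac bd = begin-strict
    ℚ.∣ a ℚ.* b ℚ.- c ℚ.* d ∣
      ≡⟨ cong ℚ.∣_∣ (solve 4
           (λ a b c d → a :* b :- c :* d := a :* (b :- d) :+ d :* (a :- c)) refl a b c d) ⟩
    ℚ.∣ a ℚ.* (b ℚ.- d) ℚ.+ d ℚ.* (a ℚ.- c) ∣
      ≤⟨ ℚ.∣p+q∣≤∣p∣+∣q∣ (a ℚ.* (b ℚ.- d)) (d ℚ.* (a ℚ.- c)) ⟩
    ℚ.∣ a ℚ.* (b ℚ.- d) ∣ ℚ.+ ℚ.∣ d ℚ.* (a ℚ.- c) ∣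
      <⟨ ℚ.+-mono-< (scale a (b ℚ.- d) 0<A a≤A bd) (scale d (a ℚ.- c) 0<B d≤B ac) ⟩
    A ℚ.* δ ℚ.+ B ℚ.* δ
      ≡⟨ ℚ.*-distribʳ-+ δ A B ⟨
    (A ℚ.+ B) ℚ.* δ ∎

  quotient : ∀ {C ε} → 0ℚ ℚ.< C → 0ℚ ℚ.< ε → ∃ λ δ → 0ℚ ℚ.< δ × C ℚ.* δ ≡ ε
  quotient {C} {ε} 0<C 0<ε = i ℚ.* ε , 0<iε , eq
    where
    instance
      C-pos : ℚ.Positive C
      C-pos = ℚ.positive 0<C
      C-nonZero : ℚ.NonZero C
      C-nonZero = ℚ.pos⇒nonZero C
    i : ℚ
    i = ℚ.1/ C
    0<iε : 0ℚ ℚ.< i ℚ.* ε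
    0<iε = subst (ℚ._< i ℚ.* ε) (ℚ.*-zeroʳ i) (ℚ.*-monoʳ-<-pos i {{ℚ.1/pos⇒pos C}} 0<ε)
    eq : C ℚ.* (i ℚ.* ε) ≡ ε
    eq = trans (sym (ℚ.*-assoc C i ε))
      (trans (cong (ℚ._* ε) (ℚ.*-inverseʳ C)) (ℚ.*-identityˡ ε))

_*ᵣ_ : ℝ → ℝ → ℝ
x *ᵣ y = mkℝ (λ n → seq x n ℚ.* seq y n) cauchy-*
  where
  Close : (ℕ → ℚ) → ℚ → ℕ → Set
  Close s ε N = ∀ m n → N ℕ.≤ m → N ℕ.≤ n → ℚ.∣ s m ℚ.- s n ∣ ℚ.< ε

  Bound : (ℕ → ℚ) → ℚ → ℕ → Set
  Bound s A N = ∀ n → N ℕ.≤ n → ℚ.∣ s n ∣ ℚ.≤ A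

  combine : ∀ {A B δ ε Nx Ny} → 0ℚ ℚ.< A → 0ℚ ℚ.< B → (A ℚ.+ B) ℚ.* δ ≡ ε →
            Bound (seq x) A Nx → Bound (seq y) B Ny →
            ∃ (Close (seq x) δ) → ∃ (Close (seq y) δ) →
            ∃ (Close (λ n → seq x n ℚ.* seq y n) ε)
  combine {Nx = Nx} {Ny} 0<A 0<B eq x≤A y≤B (N₁ , close₁) (N₂ , close₂) =
    (Nx ℕ.⊔ Ny) ℕ.⊔ (N₁ ℕ.⊔ N₂) , λ m n N≤m N≤n →
    subst (ℚ.∣ seq x m ℚ.* seq y m ℚ.- seq x n ℚ.* seq y n ∣ ℚ.<_) eq
      (product-close (seq x m) (seq y m) (seq x n) (seq y n) 0<A 0<B
        (x≤A m (ℕ.m⊔n≤o⇒m≤o Nx Ny (bnds N≤m)))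
        (y≤B n (ℕ.m⊔n≤o⇒n≤o Nx Ny (bnds N≤n)))
        (close₁ m n (ℕ.m⊔n≤o⇒m≤o N₁ N₂ (mods N≤m)) (ℕ.m⊔n≤o⇒m≤o N₁ N₂ (mods N≤n)))
        (close₂ m n (ℕ.m⊔n≤o⇒n≤o N₁ N₂ (mods N≤m)) (ℕ.m⊔n≤o⇒n≤o N₁ N₂ (mods N≤n))))
    where
    bnds : ∀ {k} → (Nx ℕ.⊔ Ny) ℕ.⊔ (N₁ ℕ.⊔ N₂) ℕ.≤ k → Nx ℕ.⊔ Ny ℕ.≤ k
    bnds = ℕ.m⊔n≤o⇒m≤o (Nx ℕ.⊔ Ny) (N₁ ℕ.⊔ N₂)
    mods : ∀ {k} → (Nx ℕ.⊔ Ny) ℕ.⊔ (N₁ ℕ.⊔ N₂) ℕ.≤ k → N₁ ℕ.⊔ N₂ ℕ.≤ k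
    mods = ℕ.m⊔n≤o⇒n≤o (Nx ℕ.⊔ Ny) (N₁ ℕ.⊔ N₂)

  refine : ∀ {A B ε Nx Ny} → 0ℚ ℚ.< A → 0ℚ ℚ.< B →
           Bound (seq x) A Nx → Bound (seq y) B Ny →
           (∃ λ δ → 0ℚ ℚ.< δ × (A ℚ.+ B) ℚ.* δ ≡ ε) →
           ∃ (Close (λ n → seq x n ℚ.* seq y n) ε)
  refine 0<A 0<B x≤A y≤B (δ , 0<δ , eq) =
    combine 0<A 0<B eq x≤A y≤B (cauchy x δ 0<δ) (cauchy y δ 0<δ)

  fromBounds : (∃₂ λ A N → 0ℚ ℚ.< A × Bound (seq x) A N) →
               (∃₂ λ B N → 0ℚ ℚ.< B × Bound (seq y) B N) →
               ∀ ε → 0ℚ ℚ.< ε → ∃ (Close (λ n → seq x n ℚ.* seq y n) ε)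
  fromBounds (_ , _ , 0<A , x≤A) (_ , _ , 0<B , y≤B) ε 0<ε =
    refine 0<A 0<B x≤A y≤B (quotient (ℚ.+-mono-< 0<A 0<B) 0<ε)

  abstract
    cauchy-* : ∀ ε → 0ℚ ℚ.< ε → ∃ (Close (λ n → seq x n ℚ.* seq y n) ε)
    cauchy-* = fromBounds (bounded x) (bounded y)

∣_∣ᵣ : ℝ → ℝ
∣ x ∣ᵣ = mkℝ (λ n → ℚ.∣ seq x n ∣) λ ε 0<ε →
  proj₁ (cauchy x ε 0<ε) , λ m n N≤m N≤n →
    ℚ.≤-<-trans (abs-diff (seq x m) (seq x n)) (proj₂ (cauchy x ε 0<ε) m n N≤m N≤n)

realRawSemiring : RawSemiring 0ℓ 0ℓ
realRawSemiring = record
  { Carrier = ℝ ; _≈_ = _≃_ ; _+_ = _+ᵣ_ ; _*_ = _*ᵣ_ ; 0# = 0ᵣ ; 1# = 1ᵣ }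

open RawSemiringOps realRawSemiring public using () renaming (_^_ to _^ᵣ_)

eval : Poly → ℝ → ℝ
eval []      t = 0ᵣ
eval (a ∷ p) t = fromℤ a +ᵣ t *ᵣ eval p t

TendsTo : (ℕ → ℝ) → ℝ → Set
TendsTo s L = ∀ ε → 0ᵣ <ᵣ ε → ∃ λ N → ∀ n → N ℕ.≤ n → ∣ s n -ᵣ L ∣ᵣ <ᵣ ε

HasSum : (ℕ → ℝ) → ℝ → Set
HasSum a S = TendsTo (partialSum realRawSemiring a) S

-- Convergence of an infinite product in the usual strict sense: besides
-- the partial products having a limit, some tail product must have a
-- nonzero limit (individual factors may vanish).

HasProduct : (ℕ → ℝ) → ℝ → Set
HasProduct a P =
  TendsTo (partialProduct realRawSemiring a) P ×
  ∃₂ λ m Q → TendsTo (partialProduct realRawSemiring (λ k → a (m ℕ.+ k))) Q × 0ᵣ <ᵣ ∣ Q ∣ᵣ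

{-# OPTIONS --safe #-}
module Submission where

-- Write T_N(x) = ∑_{n<N} B_{n+1}(t) xⁿ and Q_k(x) = ∏_{i<k} (1 + t x^(2ⁱ) + x^(2ⁱ⁺¹)).  The defining
-- recursion of the B_n gives T_{2N}(x) + B_N x^(2N) = (1 + tx + x²) T_N(x²), while
-- Q_{k+1}(x) = (1 + tx + x²) Q_k(x²); hence Q_k(x) = T_{2ᵏ}(x) + x^(2ᵏ) R_k(x), where R_k has a
-- recursion with nonnegative coefficients.  This holds in every commutative semiring.  In ℤ[t]⟦x⟧
-- it determines the coefficients of Q_k below degree 2ᵏ.  For real t and x it is used at each index
-- of the Cauchy sequences, with t and x majorised by rationals τ and ρ² < 1: nonnegativity
-- turns a bound for Q_k(τ, ρ) into the uniform estimate Q_k − T_N = O(ρᴹ) for k, N ≥ M.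

open import Algebra.Bundles using (CommutativeRing; CommutativeSemiring)
open import Algebra.Structures.Biased using (isCommutativeMonoidˡ; isCommutativeSemiringˡ)
import Algebra.Definitions.RawSemiring as RawSemiringOps
import Algebra.Properties.CommutativeSemigroup as CommutativeSemigroupProperties
import Algebra.Properties.CommutativeSemiring.Exp as CommutativeSemiringExp
import Algebra.Properties.Semiring.Exp as SemiringExp
import Algebra.Solver.Ring.NaturalCoefficients.Default as NaturalSolver
open import Data.Integer.Base as ℤ using (ℤ; 0ℤ; 1ℤ)
import Data.Integer.Properties as ℤ
open import Data.List.Base using ([]; _∷_; map)
open import Data.Nat.Base as ℕ using (ℕ; zero; suc; z≤n; s≤s)
open import Data.Nat.Induction using (<-rec)
import Data.Nat.Properties as ℕ
open import Data.Product.Base using (∃; ∃₂; _×_; _,_)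
open import Data.Rational.Base as ℚ using (ℚ; 0ℚ; 1ℚ; ½)
import Data.Rational.Properties as ℚ
open import Data.Rational.Solver using (module +-*-Solver)
import Data.Rational.Unnormalised.Base as ℚᵘ
import Data.Rational.Unnormalised.Properties as ℚᵘ
open import Data.Sum.Base using (_⊎_; inj₁; inj₂)
open import Level using (0ℓ)
import Relation.Binary.PropositionalEquality as ≡
open ≡ using (_≡_)
import Relation.Binary.Reasoning.Setoid as SetoidReasoning
open import Relation.Binary.Structures using (IsEquivalence)
open import Defs

-- For k ≥ 1 the product Q_k has degree 2ᵏ⁺¹ - 2, so it is not a truncation of the series; the
-- surplus has to be carried along explicitly, and without subtraction if the identity is to hold in
-- a semiring and to be compatible with majorants. Two demands shape the real half. A limit must be
-- exhibited as a sequence of rationals, and the operations on reals act index by index; the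
-- candidate is the diagonal of the partial products, which is Cauchy only if the estimates are
-- uniform in the index. Hence the majorants, valid from some index on. Moreover `HasProduct` asks
-- for a tail with nonzero limit. The tail from factor m on is the whole product at x^(2ᵐ), and once
-- that power is small the product stays within 1/2 of 1. The same estimate, applied to τ and ρ,
-- gives the bound for Q_k(τ, ρ).

n<2^n : ∀ n → n ℕ.< 2 ℕ.^ n
n<2^n zero    = s≤s z≤n
n<2^n (suc n) = ℕ.≤-trans (ℕ.+-mono-≤ (ℕ.m^n>0 2 n) (n<2^n n))
  (ℕ.≤-reflexive (≡.cong (2 ℕ.^ n ℕ.+_) (≡.sym (ℕ.+-identityʳ (2 ℕ.^ n)))))

-- The truncated product identity in a commutative semiring.

module SternIdentity {c ℓ} (A : CommutativeSemiring c ℓ) where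
  open CommutativeSemiring A
  open RawSemiringOps rawSemiring using (_^_)
  open SemiringExp semiring using (^-congˡ; ^-congʳ; ^-homo-*; ^-assocʳ)
  open CommutativeSemiringExp A using (^-distrib-*)
  open SetoidReasoning setoid
  open NaturalSolver A using (solve; con; _:=_; _:+_; _:*_)

  -- The recursion is imposed at n = 0 as well, where it is consistent with the two initial values;
  -- the induction step of `truncation-double` then needs no special case.
  record IsSternSequence (t : Carrier) (b : ℕ → Carrier) : Set ℓ where
    field
      zero-value : b 0 ≈ 0#
      one-value  : b 1 ≈ 1#
      even-value : ∀ n → b (2 ℕ.* n) ≈ t * b n
      odd-value  : ∀ n → b (suc (2 ℕ.* n)) ≈ b n + b (suc n)

  partialSum-cong : ∀ {a a′} → (∀ n → a n ≈ a′ n) → ∀ n →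
                    partialSum rawSemiring a n ≈ partialSum rawSemiring a′ n
  partialSum-cong a≈a′ zero    = refl
  partialSum-cong a≈a′ (suc n) = +-cong (a≈a′ 0) (partialSum-cong (λ i → a≈a′ (suc i)) n)

  partialSum-snoc : ∀ a n → partialSum rawSemiring a (suc n) ≈ partialSum rawSemiring a n + a n
  partialSum-snoc a zero    = +-comm (a 0) 0#
  partialSum-snoc a (suc n) = begin
    a 0 + partialSum rawSemiring (λ i → a (suc i)) (suc n)
      ≈⟨ +-congˡ (partialSum-snoc (λ i → a (suc i)) n) ⟩
    a 0 + (partialSum rawSemiring (λ i → a (suc i)) n + a (suc n))
      ≈⟨ +-assoc _ _ _ ⟨
    partialSum rawSemiring a (suc n) + a (suc n) ∎

  partialSum-*ˡ : ∀ y a n → partialSum rawSemiring (λ i → y * a i) n ≈ y * partialSum rawSemiring a n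
  partialSum-*ˡ y a zero    = sym (zeroʳ y)
  partialSum-*ˡ y a (suc n) =
    trans (+-congˡ (partialSum-*ˡ y (λ i → a (suc i)) n)) (sym (distribˡ y _ _))

  partialSum-++ : ∀ a m n → partialSum rawSemiring a (m ℕ.+ n) ≈
                  partialSum rawSemiring a m + partialSum rawSemiring (λ i → a (m ℕ.+ i)) n
  partialSum-++ a zero    n = sym (+-identityˡ _)
  partialSum-++ a (suc m) n =
    trans (+-congˡ (partialSum-++ (λ i → a (suc i)) m n)) (sym (+-assoc _ _ _))

  partialProduct-cong : ∀ {a a′} → (∀ n → a n ≈ a′ n) → ∀ n →
                        partialProduct rawSemiring a n ≈ partialProduct rawSemiring a′ n
  partialProduct-cong a≈a′ zero    = refl
  partialProduct-cong a≈a′ (suc n) = *-cong (a≈a′ 0) (partialProduct-cong (λ i → a≈a′ (suc i)) n)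

  square : ∀ x → x ^ 2 ≈ x * x
  square x = *-congˡ (*-identityʳ x)

  trinomial : Carrier → Carrier → Carrier
  trinomial t x = 1# + t * x + x * x

  truncation : (ℕ → Carrier) → Carrier → ℕ → Carrier
  truncation b x = partialSum rawSemiring (λ n → b (suc n) * x ^ n)

  truncation-suc : ∀ b x n → truncation b x (suc n) ≈ truncation b x n + b (suc n) * x ^ n
  truncation-suc b x = partialSum-snoc (λ n → b (suc n) * x ^ n)

  -- Peeling off the first factor and squaring the variable matches the substitution of x² for x in
  -- `truncation-double`.
  productUpTo : Carrier → Carrier → ℕ → Carrier
  productUpTo t x zero    = 1#
  productUpTo t x (suc k) = trinomial t x * productUpTo t (x * x) k

  -- The terms of degree at least 2ᵏ in the k-th partial product, divided by x^(2ᵏ).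
  excess : Carrier → (ℕ → Carrier) → Carrier → ℕ → Carrier
  excess t b x zero    = 0#
  excess t b x (suc k) = trinomial t x * excess t b (x * x) k + b (2 ℕ.^ k)

  -- Makes every tail product a full product at another point, so estimates for `productUpTo` also
  -- cover the tails in `HasProduct`.
  factor-shift : ∀ t x m k → factor rawSemiring t x (m ℕ.+ k) ≈
                 factor rawSemiring t (x ^ (2 ℕ.^ m)) k
  factor-shift t x m k = +-cong (+-congˡ (*-congˡ (shift k)))
    (trans (^-congʳ x (≡.cong (2 ℕ.^_) (≡.sym (ℕ.+-suc m k)))) (shift (suc k)))
    where
    shift : ∀ k → x ^ (2 ℕ.^ (m ℕ.+ k)) ≈ (x ^ (2 ℕ.^ m)) ^ (2 ℕ.^ k)
    shift k = trans (^-congʳ x (ℕ.^-distribˡ-+-* 2 m k)) (sym (^-assocʳ x (2 ℕ.^ m) (2 ℕ.^ k)))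

  factor-cong : ∀ t {x y} → x ≈ y → ∀ k → factor rawSemiring t x k ≈ factor rawSemiring t y k
  factor-cong t x≈y k =
    +-cong (+-congˡ (*-congˡ (^-congˡ (2 ℕ.^ k) x≈y))) (^-congˡ (2 ℕ.^ suc k) x≈y)

  partialProduct-factor : ∀ t x k →
    partialProduct rawSemiring (factor rawSemiring t x) k ≈ productUpTo t x k
  partialProduct-factor t x zero    = refl
  partialProduct-factor t x (suc k) = *-cong
    (+-cong (+-congˡ (*-congˡ (*-identityʳ x))) (square x))
    (trans
      (partialProduct-cong
        (λ i → trans (factor-shift t x 1 i) (factor-cong t (square x) i)) k)
      (partialProduct-factor t (x * x) k))

  partialProduct-factor-shift : ∀ t x m k →
    partialProduct rawSemiring (λ i → factor rawSemiring t x (m ℕ.+ i)) k ≈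
    productUpTo t (x ^ (2 ℕ.^ m)) k
  partialProduct-factor-shift t x m k =
    trans (partialProduct-cong (factor-shift t x m) k) (partialProduct-factor t (x ^ (2 ℕ.^ m)) k)

  even-power : ∀ x n → x ^ (2 ℕ.* n) ≈ x ^ n * x ^ n
  even-power x n = trans (^-congʳ x (≡.cong (n ℕ.+_) (ℕ.+-identityʳ n))) (^-homo-* x n n)

  module _ {t b} (isStern : IsSternSequence t b) where
    open IsSternSequence isStern

    -- By the recursion, B_{m+1} enters the coefficients of x^(2m), x^(2m+1) and x^(2m+2) with
    -- weights 1, t and 1, which is the trinomial times B_{m+1} x^(2m). For the last index m = n - 1
    -- the third contribution has degree 2n and lies outside the truncation; it is the extra term on
    -- the left.
    truncation-double : ∀ x n →
      truncation b x (2 ℕ.* n) + b n * x ^ (2 ℕ.* n) ≈ trinomial t x * truncation b (x * x) n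
    truncation-double x zero = begin
      0# + b 0 * 1#         ≈⟨ +-congˡ (*-congʳ zero-value) ⟩
      0# + 0# * 1#          ≈⟨ solve 2 (λ t x → con 0 :+ con 0 :* con 1 :=
                                 (con 1 :+ t :* x :+ x :* x) :* con 0) refl t x ⟩
      trinomial t x * 0#    ∎
    truncation-double x (suc n) = begin
      truncation b x (2 ℕ.* suc n) + b (suc n) * x ^ (2 ℕ.* suc n)
        ≡⟨ ≡.cong (λ k → truncation b x k + b (suc n) * x ^ k) (ℕ.*-suc 2 n) ⟩
      truncation b x (suc (suc 2n)) + b (suc n) * (x * (x * x ^ 2n))
        ≈⟨ +-congʳ (trans (truncation-suc b x (suc 2n)) (+-congʳ (truncation-suc b x 2n))) ⟩
      T + b (suc 2n) * x ^ 2n + b (suc (suc 2n)) * (x * x ^ 2n) + b (suc n) * (x * (x * x ^ 2n))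
        ≈⟨ +-congʳ (+-cong (+-congˡ (*-congʳ (odd-value n)))
             (*-congʳ (trans (reflexive (≡.cong b (≡.sym (ℕ.*-suc 2 n)))) (even-value (suc n))))) ⟩
      T + (b n + b (suc n)) * x ^ 2n + t * b (suc n) * (x * x ^ 2n) + b (suc n) * (x * (x * x ^ 2n))
        -- Splitting B_{2n+1} releases the boundary term of the induction hypothesis; the three
        -- terms with B_{n+1} form a multiple of the trinomial.
        ≈⟨ solve 6 (λ T b b′ p t x →
             T :+ (b :+ b′) :* p :+ t :* b′ :* (x :* p) :+ b′ :* (x :* (x :* p)) :=
             (T :+ b :* p) :+ (con 1 :+ t :* x :+ x :* x) :* (b′ :* p))
             refl T (b n) (b (suc n)) (x ^ 2n) t x ⟩
      (T + b n * x ^ 2n) + trinomial t x * (b (suc n) * x ^ 2n)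
        ≈⟨ +-cong (truncation-double x n)
             (*-congˡ (*-congˡ (trans (even-power x n) (sym (^-distrib-* x x n))))) ⟩
      trinomial t x * truncation b (x * x) n + trinomial t x * (b (suc n) * (x * x) ^ n)
        ≈⟨ distribˡ _ _ _ ⟨
      trinomial t x * (truncation b (x * x) n + b (suc n) * (x * x) ^ n)
        ≈⟨ *-congˡ (truncation-suc b (x * x) n) ⟨
      trinomial t x * truncation b (x * x) (suc n) ∎
      where
      2n : ℕ
      2n = 2 ℕ.* n
      T : Carrier
      T = truncation b x 2n

    -- Induction at the point x². The boundary term of `truncation-double` for N = 2ᵏ has degree
    -- exactly 2ᵏ⁺¹ and so joins the excess; this is the origin of the summand `b (2 ℕ.^ k)` there.
    truncation+excess : ∀ x k →
      truncation b x (2 ℕ.^ k) + x ^ (2 ℕ.^ k) * excess t b x k ≈ productUpTo t x k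
    truncation+excess x zero = begin
      b 1 * 1# + 0# + x * 1# * 0# ≈⟨ +-congʳ (+-congʳ (*-congʳ one-value)) ⟩
      1# * 1# + 0# + x * 1# * 0#  ≈⟨ solve 1 (λ x →
                                       con 1 :* con 1 :+ con 0 :+ x :* con 1 :* con 0 := con 1)
                                       refl x ⟩
      1# ∎
    truncation+excess x (suc k) = begin
      T + x ^ (2 ℕ.* N) * (f * E + b N)
        ≈⟨ solve 5 (λ T p f E b → T :+ p :* (f :* E :+ b) := (T :+ b :* p) :+ f :* (p :* E))
             refl T (x ^ (2 ℕ.* N)) f E (b N) ⟩
      (T + b N * x ^ (2 ℕ.* N)) + f * (x ^ (2 ℕ.* N) * E)
        ≈⟨ +-cong (truncation-double x N)
             (*-congˡ (*-congʳ (trans (even-power x N) (sym (^-distrib-* x x N))))) ⟩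
      f * truncation b (x * x) N + f * ((x * x) ^ N * E)
        ≈⟨ distribˡ _ _ _ ⟨
      f * (truncation b (x * x) N + (x * x) ^ N * E)
        ≈⟨ *-congˡ (truncation+excess (x * x) k) ⟩
      f * productUpTo t (x * x) k ∎
      where
      N : ℕ
      N = 2 ℕ.^ k
      T f E : Carrier
      T = truncation b x (2 ℕ.* N)
      f = trinomial t x
      E = excess t b (x * x) k

-- Cauchy products of sequences over a commutative semiring.

module Convolution {c ℓ} (A : CommutativeSemiring c ℓ) where
  open CommutativeSemiring A
  open SetoidReasoning setoid
  open NaturalSolver A using (solve; con; _:=_; _:+_; _:*_)
  open SternIdentity A using (partialSum-cong)

  infixl 7 _⊛_

  _⊛_ : (ℕ → Carrier) → (ℕ → Carrier) → ℕ → Carrier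
  (f ⊛ g) n = partialSum rawSemiring (λ i → f i * g (n ℕ.∸ i)) (suc n)

  tail : (ℕ → Carrier) → ℕ → Carrier
  tail f n = f (suc n)

  ⊛-cong : ∀ {f f′ g g′} → (∀ n → f n ≈ f′ n) → (∀ n → g n ≈ g′ n) →
           ∀ n → (f ⊛ g) n ≈ (f′ ⊛ g′) n
  ⊛-cong f≈f′ g≈g′ n = partialSum-cong (λ i → *-cong (f≈f′ i) (g≈g′ (n ℕ.∸ i))) (suc n)

  -- The sum unfolds definitionally at the end where `f` has index 0; this is the other end, which
  -- commutativity needs.
  ⊛-suc : ∀ f g n → (f ⊛ g) (suc n) ≈ (f ⊛ tail g) n + f (suc n) * g 0
  ⊛-suc f g zero    = solve 2 (λ a b → a :+ (b :+ con 0) := (a :+ con 0) :+ b)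
                        refl (f 0 * g 1) (f 1 * g 0)
  ⊛-suc f g (suc n) = trans (+-congˡ (⊛-suc (tail f) g n)) (sym (+-assoc _ _ _))

  ⊛-comm : ∀ f g n → (f ⊛ g) n ≈ (g ⊛ f) n
  ⊛-comm f g zero    = +-congʳ (*-comm (f 0) (g 0))
  ⊛-comm f g (suc n) = begin
    f 0 * g (suc n) + (tail f ⊛ g) n ≈⟨ +-cong (*-comm _ _) (⊛-comm (tail f) g n) ⟩
    g (suc n) * f 0 + (g ⊛ tail f) n ≈⟨ +-comm _ _ ⟩
    (g ⊛ tail f) n + g (suc n) * f 0 ≈⟨ ⊛-suc g f n ⟨
    (g ⊛ f) (suc n)                  ∎

  ⊛-distribʳ : ∀ h f g n → ((λ i → f i + g i) ⊛ h) n ≈ (f ⊛ h) n + (g ⊛ h) n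
  ⊛-distribʳ h f g zero    = solve 3 (λ h f g → (f :+ g) :* h :+ con 0 :=
                               (f :* h :+ con 0) :+ (g :* h :+ con 0)) refl (h 0) (f 0) (g 0)
  ⊛-distribʳ h f g (suc n) = trans (+-congˡ (⊛-distribʳ h (tail f) (tail g) n))
    (solve 5 (λ h f g F G → (f :+ g) :* h :+ (F :+ G) := (f :* h :+ F) :+ (g :* h :+ G))
      refl (h (suc n)) (f 0) (g 0) ((tail f ⊛ h) n) ((tail g ⊛ h) n))

  ⊛-scaleˡ : ∀ a f g n → ((λ i → a * f i) ⊛ g) n ≈ a * (f ⊛ g) n
  ⊛-scaleˡ a f g zero    = solve 3 (λ a f g → a :* f :* g :+ con 0 := a :* (f :* g :+ con 0))
                             refl a (f 0) (g 0)
  ⊛-scaleˡ a f g (suc n) = trans (+-congˡ (⊛-scaleˡ a (tail f) g n))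
    (solve 4 (λ a f g F → a :* f :* g :+ a :* F := a :* (f :* g :+ F))
      refl a (f 0) (g (suc n)) ((tail f ⊛ g) n))

  -- The tail of f ⊛ g is definitionally f 0 · tail g + tail f ⊛ g, so distributivity and scaling
  -- leave the same claim for tail f at a smaller index.
  ⊛-assoc : ∀ f g h n → ((f ⊛ g) ⊛ h) n ≈ (f ⊛ (g ⊛ h)) n
  ⊛-assoc f g h zero    = solve 3 (λ f g h → (f :* g :+ con 0) :* h :+ con 0 :=
                            f :* (g :* h :+ con 0) :+ con 0) refl (f 0) (g 0) (h 0)
  ⊛-assoc f g h (suc n) = begin
    (f 0 * g 0 + 0#) * h (suc n) + (tail (f ⊛ g) ⊛ h) n
      ≈⟨ +-congˡ (⊛-distribʳ h (λ i → f 0 * g (suc i)) (tail f ⊛ g) n) ⟩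
    (f 0 * g 0 + 0#) * h (suc n) + (((λ i → f 0 * g (suc i)) ⊛ h) n + ((tail f ⊛ g) ⊛ h) n)
      ≈⟨ +-congˡ (+-cong (⊛-scaleˡ (f 0) (tail g) h n) (⊛-assoc (tail f) g h n)) ⟩
    (f 0 * g 0 + 0#) * h (suc n) + (f 0 * (tail g ⊛ h) n + (tail f ⊛ (g ⊛ h)) n)
      ≈⟨ solve 5 (λ f g h G F → (f :* g :+ con 0) :* h :+ (f :* G :+ F) := f :* (g :* h :+ G) :+ F)
           refl (f 0) (g 0) (h (suc n)) ((tail g ⊛ h) n) ((tail f ⊛ (g ⊛ h)) n) ⟩
    f 0 * (g ⊛ h) (suc n) + (tail f ⊛ (g ⊛ h)) n ∎

  ⊛-zeroˡ : ∀ {z} → (∀ n → z n ≈ 0#) → ∀ g n → (z ⊛ g) n ≈ 0#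
  ⊛-zeroˡ z≈0 g zero    = trans (+-identityʳ _) (trans (*-congʳ (z≈0 0)) (zeroˡ (g 0)))
  ⊛-zeroˡ z≈0 g (suc n) = trans
    (+-cong (trans (*-congʳ (z≈0 0)) (zeroˡ _)) (⊛-zeroˡ (λ i → z≈0 (suc i)) g n))
    (+-identityʳ 0#)

  -- Phrased through the values of k so that it covers `coeff 1ₚ`, `constₛ p` and the shift of `xₛ`
  -- alike.
  ⊛-constˡ : ∀ {a k} → k 0 ≈ a → (∀ n → k (suc n) ≈ 0#) → ∀ g n → (k ⊛ g) n ≈ a * g n
  ⊛-constˡ k₀≈a kₙ≈0 g zero    = trans (+-identityʳ _) (*-congʳ k₀≈a)
  ⊛-constˡ k₀≈a kₙ≈0 g (suc n) = trans (+-cong (*-congʳ k₀≈a) (⊛-zeroˡ kₙ≈0 g n)) (+-identityʳ _)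

-- Polynomials and power series as commutative semirings.

module ℤConvolution = Convolution ℤ.+-*-commutativeSemiring

coeff-+ : ∀ p q i → coeff (p +ₚ q) i ≡ coeff p i ℤ.+ coeff q i
coeff-+ []      q       i       = ≡.sym (ℤ.+-identityˡ (coeff q i))
coeff-+ (a ∷ p) []      i       = ≡.sym (ℤ.+-identityʳ (coeff (a ∷ p) i))
coeff-+ (a ∷ p) (b ∷ q) zero    = ≡.refl
coeff-+ (a ∷ p) (b ∷ q) (suc i) = coeff-+ p q i

coeff-map-* : ∀ a q i → coeff (map (a ℤ.*_) q) i ≡ a ℤ.* coeff q i
coeff-map-* a []      i       = ≡.sym (ℤ.*-zeroʳ a)
coeff-map-* a (b ∷ q) zero    = ≡.refl
coeff-map-* a (b ∷ q) (suc i) = coeff-map-* a q i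

-- The recursion of `_*ₚ_` on the first list is the unfolding of ⊛. The multiplicative laws thereby
-- move to integer sequences, where trailing zeros are invisible.
coeff-* : ∀ p q i → coeff (p *ₚ q) i ≡ (coeff p ℤConvolution.⊛ coeff q) i
coeff-* []      q i       = ≡.sym (ℤConvolution.⊛-zeroˡ (λ _ → ≡.refl) (coeff q) i)
coeff-* (a ∷ p) q zero    = ≡.trans (coeff-+ (map (a ℤ.*_) q) _ 0)
  (≡.cong (ℤ._+ 0ℤ) (coeff-map-* a q 0))
coeff-* (a ∷ p) q (suc i) = ≡.trans (coeff-+ (map (a ℤ.*_) q) _ (suc i))
  (≡.cong₂ ℤ._+_ (coeff-map-* a q (suc i)) (coeff-* p q i))

polyCommutativeSemiring : CommutativeSemiring 0ℓ 0ℓ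
polyCommutativeSemiring = record
  { Carrier = Poly ; _≈_ = _≈ₚ_ ; _+_ = _+ₚ_ ; _*_ = _*ₚ_ ; 0# = 0ₚ ; 1# = 1ₚ
  ; isCommutativeSemiring = isCommutativeSemiringˡ record
    { +-isCommutativeMonoid = isCommutativeMonoidˡ record
      { isSemigroup = record
        { isMagma = record
          { isEquivalence = ≈ₚ-isEquivalence
          ; ∙-cong = λ {p} {p′} {q} {q′} p≈p′ q≈q′ i → coeff-+ p q i ⟨≡⟩
              ≡.cong₂ ℤ._+_ (p≈p′ i) (q≈q′ i) ⟨≡⟩ ≡.sym (coeff-+ p′ q′ i)
          }
        ; assoc = λ p q r i →
            coeff-+ (p +ₚ q) r i ⟨≡⟩ ≡.cong (ℤ._+ coeff r i) (coeff-+ p q i) ⟨≡⟩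
            ℤ.+-assoc (coeff p i) (coeff q i) (coeff r i) ⟨≡⟩
            ≡.sym (coeff-+ p (q +ₚ r) i ⟨≡⟩ ≡.cong (λ s → coeff p i ℤ.+ s) (coeff-+ q r i))
        }
      ; identityˡ = λ p i → ≡.refl
      ; comm = λ p q i → coeff-+ p q i ⟨≡⟩
          ℤ.+-comm (coeff p i) (coeff q i) ⟨≡⟩ ≡.sym (coeff-+ q p i)
      }
    ; *-isCommutativeMonoid = isCommutativeMonoidˡ record
      { isSemigroup = record
        { isMagma = record
          { isEquivalence = ≈ₚ-isEquivalence
          ; ∙-cong = λ {p} {p′} {q} {q′} p≈p′ q≈q′ i → coeff-* p q i ⟨≡⟩
              ⊛-cong p≈p′ q≈q′ i ⟨≡⟩ ≡.sym (coeff-* p′ q′ i)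
          }
        ; assoc = λ p q r i →
            coeff-* (p *ₚ q) r i ⟨≡⟩ ⊛-cong {g = coeff r} (coeff-* p q) (λ _ → ≡.refl) i ⟨≡⟩
            ⊛-assoc (coeff p) (coeff q) (coeff r) i ⟨≡⟩
            ≡.sym (coeff-* p (q *ₚ r) i ⟨≡⟩ ⊛-cong {coeff p} (λ _ → ≡.refl) (coeff-* q r) i)
        }
      ; identityˡ = λ p i → coeff-* 1ₚ p i ⟨≡⟩
          ⊛-constˡ {k = coeff 1ₚ} ≡.refl (λ _ → ≡.refl) (coeff p) i ⟨≡⟩ ℤ.*-identityˡ (coeff p i)
      ; comm = λ p q i → coeff-* p q i ⟨≡⟩ ⊛-comm (coeff p) (coeff q) i ⟨≡⟩ ≡.sym (coeff-* q p i)
      }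
    ; distribʳ = λ r p q i →
        coeff-* (p +ₚ q) r i ⟨≡⟩ ⊛-cong {g = coeff r} (coeff-+ p q) (λ _ → ≡.refl) i ⟨≡⟩
        ⊛-distribʳ (coeff r) (coeff p) (coeff q) i ⟨≡⟩
        ≡.sym (coeff-+ (p *ₚ r) (q *ₚ r) i ⟨≡⟩ ≡.cong₂ ℤ._+_ (coeff-* p r i) (coeff-* q r i))
    ; zeroˡ = λ p i → ≡.refl
    }
  }
  where
  open ℤConvolution
  infixr 5 _⟨≡⟩_
  _⟨≡⟩_ : ∀ {x y z : ℤ} → x ≡ y → y ≡ z → x ≡ z
  _⟨≡⟩_ = ≡.trans
  ≈ₚ-isEquivalence : IsEquivalence _≈ₚ_
  ≈ₚ-isEquivalence = record
    { refl = λ _ → ≡.refl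
    ; sym = λ p≈q i → ≡.sym (p≈q i)
    ; trans = λ p≈q q≈r i → ≡.trans (p≈q i) (q≈r i)
    }

module ℤ[t] = CommutativeSemiring polyCommutativeSemiring

-- Since `_*ₛ_` is definitionally ⊛ over ℤ[t], the convolution laws apply without transport.
seriesCommutativeSemiring : CommutativeSemiring 0ℓ 0ℓ
seriesCommutativeSemiring = record
  { Carrier = Series ; _≈_ = _≈ₛ_ ; _+_ = _+ₛ_ ; _*_ = _*ₛ_ ; 0# = constₛ 0ₚ ; 1# = constₛ 1ₚ
  ; isCommutativeSemiring = isCommutativeSemiringˡ record
    { +-isCommutativeMonoid = isCommutativeMonoidˡ record
      { isSemigroup = record
        { isMagma = record
          { isEquivalence = ≈ₛ-isEquivalence
          ; ∙-cong = λ {f} {f′} {g} {g′} f≈f′ g≈g′ n →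
              ℤ[t].+-cong {f n} {f′ n} {g n} {g′ n} (f≈f′ n) (g≈g′ n)
          }
        ; assoc = λ f g h n → ℤ[t].+-assoc (f n) (g n) (h n)
        }
      ; identityˡ = λ { f zero → ℤ[t].refl {f 0} ; f (suc n) → ℤ[t].refl {f (suc n)} }
      ; comm = λ f g n → ℤ[t].+-comm (f n) (g n)
      }
    ; *-isCommutativeMonoid = isCommutativeMonoidˡ record
      { isSemigroup = record
        { isMagma = record
          { isEquivalence = ≈ₛ-isEquivalence
          ; ∙-cong = λ {f} {f′} {g} {g′} → ⊛-cong {f} {f′} {g} {g′}
          }
        ; assoc = ⊛-assoc
        }
      ; identityˡ = λ f n → ℤ[t].trans {(constₛ 1ₚ *ₛ f) n} {1ₚ *ₚ f n} {f n}
          (⊛-constˡ {1ₚ} {constₛ 1ₚ} (λ _ → ≡.refl) (λ _ _ → ≡.refl) f n)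
          (ℤ[t].*-identityˡ (f n))
      ; comm = ⊛-comm
      }
    ; distribʳ = ⊛-distribʳ
    ; zeroˡ = λ f n → ℤ[t].trans {(constₛ 0ₚ *ₛ f) n} {0ₚ} {constₛ 0ₚ n}
        (⊛-zeroˡ {constₛ 0ₚ} constₛ-0 f n) (λ i → ≡.sym (constₛ-0 n i))
    }
  }
  where
  open Convolution polyCommutativeSemiring
  ≈ₛ-isEquivalence : IsEquivalence _≈ₛ_
  ≈ₛ-isEquivalence = record
    { refl = λ _ _ → ≡.refl
    ; sym = λ f≈g n i → ≡.sym (f≈g n i)
    ; trans = λ f≈g g≈h n i → ≡.trans (f≈g n i) (g≈h n i)
    }
  constₛ-0 : ∀ n → constₛ 0ₚ n ≈ₚ 0ₚ
  constₛ-0 zero    _ = ≡.refl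
  constₛ-0 (suc _) _ = ≡.refl

-- The identity of formal power series.

stern-2*n : ∀ n → stern (2 ℕ.* n) ≈ₚ tₚ *ₚ stern n
-- Here the product is a list of zeros and not the empty list, hence ≈ₚ in place of ≡.
stern-2*n zero      = ℤ[t].sym {tₚ *ₚ 0ₚ} {0ₚ} (ℤ[t].zeroʳ tₚ)
stern-2*n n@(suc _) = ℤ[t].reflexive (stern-even n (s≤s z≤n))

stern-1+2*n : ∀ n → stern (suc (2 ℕ.* n)) ≡ stern n +ₚ stern (suc n)
stern-1+2*n zero      = ≡.refl
stern-1+2*n n@(suc _) = ≡.trans (≡.cong stern (≡.sym (ℕ.+-comm (2 ℕ.* n) 1)))
  (≡.trans (stern-odd n (s≤s z≤n)) (≡.cong (λ k → stern n +ₚ stern k) (ℕ.+-comm n 1)))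

module ℤ[t]⟦x⟧ = CommutativeSemiring seriesCommutativeSemiring

module FormalIdentity where
  open Convolution polyCommutativeSemiring using (⊛-constˡ)
  open SternIdentity seriesCommutativeSemiring
  open RawSemiringOps seriesRawSemiring using (_^_)

  constₛ-*ₛ : ∀ p f n → (constₛ p *ₛ f) n ≈ₚ p *ₚ f n
  constₛ-*ₛ p f = ⊛-constˡ {p} {constₛ p} (λ _ → ≡.refl) (λ _ _ → ≡.refl) f

  xₛ*-zero : ∀ f → (xₛ *ₛ f) 0 ≈ₚ 0ₚ
  xₛ*-zero f _ = ≡.refl

  xₛ*-suc : ∀ f n → (xₛ *ₛ f) (suc n) ≈ₚ f n
  xₛ*-suc f n = begin
    (xₛ *ₛ f) (suc n)                ≡⟨⟩
    ((λ i → xₛ (suc i)) *ₛ f) n      ≈⟨ ⊛-constˡ {1ₚ} {λ i → xₛ (suc i)}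
                                          (λ _ → ≡.refl) (λ _ _ → ≡.refl) f n ⟩
    1ₚ *ₚ f n                        ≈⟨ ℤ[t].*-identityˡ (f n) ⟩
    f n                              ∎
    where open SetoidReasoning ℤ[t].setoid

  -- Embedding the polynomials as constant series allows `truncation+excess` to be applied inside
  -- ℤ[t]⟦x⟧, at the indeterminate itself.
  constₛ-stern : IsSternSequence (constₛ tₚ) (λ n → constₛ (stern n))
  constₛ-stern = record
    { zero-value = λ _ _ → ≡.refl
    ; one-value  = λ _ _ → ≡.refl
    ; even-value = even
    ; odd-value  = odd
    }
    where
    even : ∀ n → constₛ (stern (2 ℕ.* n)) ≈ₛ constₛ tₚ *ₛ constₛ (stern n)
    even n zero    = ℤ[t].trans {stern (2 ℕ.* n)} {tₚ *ₚ stern n} {(constₛ tₚ *ₛ constₛ (stern n)) 0}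
      (stern-2*n n)
      (ℤ[t].sym {(constₛ tₚ *ₛ constₛ (stern n)) 0} {tₚ *ₚ stern n} (constₛ-*ₛ tₚ (constₛ (stern n)) 0))
    even n (suc m) = ℤ[t].sym {(constₛ tₚ *ₛ constₛ (stern n)) (suc m)} {0ₚ}
      (ℤ[t].trans {(constₛ tₚ *ₛ constₛ (stern n)) (suc m)} {tₚ *ₚ 0ₚ} {0ₚ}
        (constₛ-*ₛ tₚ (constₛ (stern n)) (suc m)) (ℤ[t].zeroʳ tₚ))
    odd : ∀ n → constₛ (stern (suc (2 ℕ.* n))) ≈ₛ constₛ (stern n) +ₛ constₛ (stern (suc n))
    odd n zero    = ℤ[t].reflexive (stern-1+2*n n)
    odd n (suc m) = λ _ → ≡.refl

  -- All terms after the first share a factor `xₛ`; pulling it out lowers the coefficient index by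
  -- one.
  coefficient-partialSum : ∀ (p : ℕ → Poly) N n → n ℕ.< N →
    partialSum seriesRawSemiring (λ i → constₛ (p i) *ₛ xₛ ^ i) N n ≈ₚ p n
  coefficient-partialSum p (suc N) n n<N = begin
    (constₛ (p 0) *ₛ constₛ 1ₚ) n +ₚ
      partialSum seriesRawSemiring (λ i → constₛ (p (suc i)) *ₛ (xₛ *ₛ xₛ ^ i)) N n
      ≈⟨ ℤ[t].+-cong {(constₛ (p 0) *ₛ constₛ 1ₚ) n} {constₛ (p 0) n}
           (ℤ[t]⟦x⟧.*-identityʳ (constₛ (p 0)) n) (factor-out n) ⟩
    constₛ (p 0) n +ₚ (xₛ *ₛ tail) n
      ≈⟨ split n n<N ⟩
    p n ∎
    where
    open SetoidReasoning ℤ[t].setoid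
    tail : Series
    tail = partialSum seriesRawSemiring (λ i → constₛ (p (suc i)) *ₛ xₛ ^ i) N
    swap : ∀ f g → f *ₛ (xₛ *ₛ g) ≈ₛ xₛ *ₛ (f *ₛ g)
    swap f g = x∙yz≈y∙xz f xₛ g
      where open CommutativeSemigroupProperties ℤ[t]⟦x⟧.*-commutativeSemigroup
    term term′ : ℕ → Series
    term  i = constₛ (p (suc i)) *ₛ (xₛ *ₛ xₛ ^ i)
    term′ i = xₛ *ₛ (constₛ (p (suc i)) *ₛ xₛ ^ i)
    factor-out : partialSum seriesRawSemiring term N ≈ₛ xₛ *ₛ tail
    factor-out = ℤ[t]⟦x⟧.trans {partialSum seriesRawSemiring term N}
      {partialSum seriesRawSemiring term′ N} {xₛ *ₛ tail}
      (partialSum-cong {term} {term′} (λ i → swap (constₛ (p (suc i))) (xₛ ^ i)) N)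
      (partialSum-*ˡ xₛ (λ i → constₛ (p (suc i)) *ₛ xₛ ^ i) N)
    split : ∀ n → n ℕ.< suc N → constₛ (p 0) n +ₚ (xₛ *ₛ tail) n ≈ₚ p n
    split zero    _         = ℤ[t].+-identityʳ (p 0)
    split (suc m) (s≤s m<N) = begin
      (xₛ *ₛ tail) (suc m) ≈⟨ xₛ*-suc tail m ⟩
      tail m               ≈⟨ coefficient-partialSum (λ i → p (suc i)) N m m<N ⟩
      p (suc m)            ∎

  coefficient-xₛ^* : ∀ N f n → n ℕ.< N → (xₛ ^ N *ₛ f) n ≈ₚ 0ₚ
  coefficient-xₛ^* (suc N) f zero    _         = ℤ[t].trans {(xₛ ^ suc N *ₛ f) 0} {(xₛ *ₛ (xₛ ^ N *ₛ f)) 0} {0ₚ}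
    (ℤ[t]⟦x⟧.*-assoc xₛ (xₛ ^ N) f 0) (xₛ*-zero (xₛ ^ N *ₛ f))
  coefficient-xₛ^* (suc N) f (suc n) (s≤s n<N) = begin
    (xₛ ^ suc N *ₛ f) (suc n)          ≈⟨ ℤ[t]⟦x⟧.*-assoc xₛ (xₛ ^ N) f (suc n) ⟩
    (xₛ *ₛ (xₛ ^ N *ₛ f)) (suc n)      ≈⟨ xₛ*-suc (xₛ ^ N *ₛ f) n ⟩
    (xₛ ^ N *ₛ f) n                    ≈⟨ coefficient-xₛ^* N f n n<N ⟩
    0ₚ                                 ∎
    where open SetoidReasoning ℤ[t].setoid

  hasProduct : HasProductₛ (factor seriesRawSemiring (constₛ tₚ) xₛ) (λ n → stern (suc n))
  -- The bound n itself suffices: n < 2ⁿ ≤ 2ᴷ puts degree n inside the truncation and below the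
  -- excess.
  hasProduct n = n , λ K n≤K → let n<2^K = ℕ.<-≤-trans (n<2^n n) (ℕ.^-monoʳ-≤ 2 n≤K) in begin
    partialProduct seriesRawSemiring (factor seriesRawSemiring (constₛ tₚ) xₛ) K n
      ≈⟨ partialProduct-factor (constₛ tₚ) xₛ K n ⟩
    productUpTo (constₛ tₚ) xₛ K n
      ≈⟨ ℤ[t].sym {(T K +ₛ xₛ ^ (2 ℕ.^ K) *ₛ E K) n} {productUpTo (constₛ tₚ) xₛ K n}
           (truncation+excess constₛ-stern xₛ K n) ⟩
    T K n +ₚ (xₛ ^ (2 ℕ.^ K) *ₛ E K) n
      ≈⟨ ℤ[t].+-cong {T K n} {stern (suc n)}
           (coefficient-partialSum (λ i → stern (suc i)) (2 ℕ.^ K) n n<2^K)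
           (coefficient-xₛ^* (2 ℕ.^ K) (E K) n n<2^K) ⟩
    stern (suc n) +ₚ 0ₚ
      ≈⟨ ℤ[t].+-identityʳ (stern (suc n)) ⟩
    stern (suc n) ∎
    where
    open SetoidReasoning ℤ[t].setoid
    T E : ℕ → Series
    T K = truncation (λ m → constₛ (stern m)) xₛ (2 ℕ.^ K)
    E   = excess (constₛ tₚ) (λ m → constₛ (stern m)) xₛ

  stern-series : stern ≈ₛ xₛ *ₛ (λ n → stern (suc n))
  stern-series zero    = λ _ → ≡.refl
  stern-series (suc n) =
    ℤ[t].sym {(xₛ *ₛ (λ i → stern (suc i))) (suc n)} {stern (suc n)} (xₛ*-suc (λ i → stern (suc i)) n)

-- Stern values at rational points, majorants and small powers.

parity : ∀ n → ∃ λ k → n ≡ 2 ℕ.* k ⊎ n ≡ suc (2 ℕ.* k)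
parity zero    = 0 , inj₁ ≡.refl
parity (suc n) with parity n
... | k , inj₁ n≡2k   = k , inj₂ (≡.cong suc n≡2k)
... | k , inj₂ n≡1+2k = suc k , inj₁ (≡.trans (≡.cong suc n≡1+2k) (≡.sym (ℕ.*-suc 2 k)))

-- From 2 on, the indices to which the recursion refers are strictly smaller. At 1 = 2·0 + 1 the odd
-- step would refer back to 1, so 1 is a base case.
stern-induction : ∀ {ℓ} (P : ℕ → Set ℓ) → P 0 → P 1 → (∀ n → P n → P (2 ℕ.* n)) →
                  (∀ n → P n → P (suc n) → P (suc (2 ℕ.* n))) → ∀ n → P n
stern-induction P P0 P1 even odd = <-rec P step
  where
  step : ∀ n → (∀ {m} → m ℕ.< n → P m) → P n
  step 0 _ = P0
  step 1 _ = P1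
  step n@(suc (suc _)) rec with parity n
  ... | suc k , inj₁ n≡2k   = ≡.subst P (≡.sym n≡2k)
    (even (suc k) (rec (≡.subst (suc k ℕ.<_) (≡.sym n≡2k) (ℕ.m<m+n (suc k) (s≤s z≤n)))))
  ... | suc k , inj₂ n≡1+2k = ≡.subst P (≡.sym n≡1+2k) (odd (suc k) (rec (ℕ.<-trans (ℕ.n<1+n _) 2+k<n)) (rec 2+k<n))
    where
    2+k<n : suc (suc k) ℕ.< n
    2+k<n = ≡.subst (suc (suc k) ℕ.<_) (≡.sym n≡1+2k) (s≤s (ℕ.m<m+n (suc k) (s≤s z≤n)))

module RationalBounds where
  open import Data.Rational.Base using (_+_; _*_; _-_; -_; ∣_∣; _≤_; _<_)
  open ℚ.≤-Reasoning
  open +-*-Solver using (solve; _:=_; _:+_; _:*_; _:-_; con)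
  ℚ-semiring : CommutativeSemiring 0ℓ 0ℓ
  ℚ-semiring = CommutativeRing.commutativeSemiring ℚ.+-*-commutativeRing
  open CommutativeSemiring ℚ-semiring public using (rawSemiring)
  open SternIdentity ℚ-semiring public
  open RawSemiringOps rawSemiring public using (_^_)

  evalℚ : Poly → ℚ → ℚ
  evalℚ []      t = 0ℚ
  evalℚ (a ∷ p) t = (a ℚ./ 1) + t * evalℚ p t

  /1-+ : ∀ a b → (a ℤ.+ b) ℚ./ 1 ≡ (a ℚ./ 1) + (b ℚ./ 1)
  /1-+ a b = ℚ.toℚᵘ-injective (ℚᵘ.≃-trans (ℚ.toℚᵘ-fromℚᵘ (ℚᵘ.mkℚᵘ (a ℤ.+ b) 0))
    (ℚᵘ.≃-trans (ℚᵘ.*≡* (≡.cong (ℤ._* 1ℤ) (≡.sym (≡.cong₂ ℤ._+_ (ℤ.*-identityʳ a) (ℤ.*-identityʳ b)))))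
      (ℚᵘ.≃-sym (ℚᵘ.≃-trans (ℚ.toℚᵘ-homo-+ (a ℚ./ 1) (b ℚ./ 1))
        (ℚᵘ.+-cong (ℚ.toℚᵘ-fromℚᵘ (ℚᵘ.mkℚᵘ a 0)) (ℚ.toℚᵘ-fromℚᵘ (ℚᵘ.mkℚᵘ b 0)))))))

  evalℚ-+ : ∀ p q t → evalℚ (p +ₚ q) t ≡ evalℚ p t + evalℚ q t
  evalℚ-+ []      q       t = ≡.sym (ℚ.+-identityˡ (evalℚ q t))
  evalℚ-+ (a ∷ p) []      t = ≡.sym (ℚ.+-identityʳ (evalℚ (a ∷ p) t))
  evalℚ-+ (a ∷ p) (b ∷ q) t = ≡.trans
    (≡.cong₂ (λ u v → u + t * v) (/1-+ a b) (evalℚ-+ p q t))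
    (solve 5 (λ a b t p q → (a :+ b) :+ t :* (p :+ q) := (a :+ t :* p) :+ (b :+ t :* q))
      ≡.refl (a ℚ./ 1) (b ℚ./ 1) t (evalℚ p t) (evalℚ q t))

  evalℚ-0 : ∀ p t → p ≈ₚ 0ₚ → evalℚ p t ≡ 0ℚ
  evalℚ-0 []      t p≈0 = ≡.refl
  evalℚ-0 (a ∷ p) t p≈0 = ≡.trans
    (≡.cong₂ (λ u v → (u ℚ./ 1) + t * v) (p≈0 0) (evalℚ-0 p t (λ i → p≈0 (suc i))))
    (≡.trans (ℚ.+-identityˡ (t * 0ℚ)) (ℚ.*-zeroʳ t))

  evalℚ-cong : ∀ p q t → p ≈ₚ q → evalℚ p t ≡ evalℚ q t
  evalℚ-cong []      q       t p≈q = ≡.sym (evalℚ-0 q t (λ i → ≡.sym (p≈q i)))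
  evalℚ-cong (a ∷ p) []      t p≈q = evalℚ-0 (a ∷ p) t p≈q
  evalℚ-cong (a ∷ p) (b ∷ q) t p≈q =
    ≡.cong₂ (λ u v → (u ℚ./ 1) + t * v) (p≈q 0) (evalℚ-cong p q t (λ i → p≈q (suc i)))

  -- Spares a proof that `evalℚ` is multiplicative: t is the only multiplier in the recursion, and
  -- `evalℚ` unfolds on `0ℤ ∷ p`.
  tₚ*p≈0∷p : ∀ p → tₚ *ₚ p ≈ₚ 0ℤ ∷ p
  tₚ*p≈0∷p p zero    = ≡.trans (coeff-* tₚ p 0) ≡.refl
  tₚ*p≈0∷p p (suc i) = ≡.trans (coeff-* tₚ p (suc i)) (≡.trans (ℤ.+-identityˡ _)
    (≡.trans (ℤConvolution.⊛-constˡ {1ℤ} {coeff 1ₚ} ≡.refl (λ _ → ≡.refl) (coeff p) i)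
      (ℤ.*-identityˡ (coeff p i))))

  sternℚ : ℚ → ℕ → ℚ
  sternℚ t n = evalℚ (stern n) t

  sternℚ-isStern : ∀ t → IsSternSequence t (sternℚ t)
  sternℚ-isStern t = record
    { zero-value = ≡.refl
    ; one-value  = ≡.trans (≡.cong (1ℚ +_) (ℚ.*-zeroʳ t)) (ℚ.+-identityʳ 1ℚ)
    ; even-value = λ n → ≡.trans (evalℚ-cong (stern (2 ℕ.* n)) (0ℤ ∷ stern n) t
        (λ i → ≡.trans (stern-2*n n i) (tₚ*p≈0∷p (stern n) i))) (ℚ.+-identityˡ (t * sternℚ t n))
    ; odd-value  = λ n → ≡.trans (≡.cong (λ p → evalℚ p t) (stern-1+2*n n))
        (evalℚ-+ (stern n) (stern (suc n)) t)
    }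

  *-mono-≤ : ∀ {a b c d} → 0ℚ ≤ a → 0ℚ ≤ d → a ≤ b → c ≤ d → a * c ≤ b * d
  *-mono-≤ {a} {b} {c} {d} 0≤a 0≤d a≤b c≤d = ℚ.≤-trans
    (ℚ.*-monoˡ-≤-nonNeg a {{ℚ.nonNegative 0≤a}} c≤d)
    (ℚ.*-monoʳ-≤-nonNeg d {{ℚ.nonNegative 0≤d}} a≤b)

  0≤1 : 0ℚ ≤ 1ℚ
  0≤1 = ℚ.nonNegative⁻¹ 1ℚ

  0≤* : ∀ {a b} → 0ℚ ≤ a → 0ℚ ≤ b → 0ℚ ≤ a * b
  0≤* {a} {b} 0≤a 0≤b = ≡.subst (_≤ a * b) (ℚ.*-zeroˡ 0ℚ) (*-mono-≤ ℚ.≤-refl 0≤b 0≤a 0≤b)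

  0≤^ : ∀ {a} n → 0ℚ ≤ a → 0ℚ ≤ a ^ n
  0≤^ zero    0≤a = 0≤1
  0≤^ (suc n) 0≤a = 0≤* 0≤a (0≤^ n 0≤a)

  ≤-*ˡ : ∀ {a b} c → 0ℚ ≤ c → a ≤ b → c * a ≤ c * b
  ≤-*ˡ c 0≤c a≤b = ℚ.*-monoˡ-≤-nonNeg c {{ℚ.nonNegative 0≤c}} a≤b

  ≤-+ʳ : ∀ {a b} → 0ℚ ≤ b → a ≤ a + b
  ≤-+ʳ {a} {b} 0≤b = ≡.subst (_≤ a + b) (ℚ.+-identityʳ a) (ℚ.+-monoʳ-≤ a 0≤b)

  infix 4 _≼_

  -- Majorisation. Being preserved by sums and products, it bounds every subtraction-free expression
  -- in t and x by the same expression in τ and ρ.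
  _≼_ : ℚ → ℚ → Set
  p ≼ P = ∣ p ∣ ≤ P

  ≼⇒0≤ : ∀ {p P} → p ≼ P → 0ℚ ≤ P
  ≼⇒0≤ {p} p≼P = ℚ.≤-trans (ℚ.0≤∣p∣ p) p≼P

  0≤⇒≼ : ∀ {p} → 0ℚ ≤ p → p ≼ p
  0≤⇒≼ 0≤p = ℚ.≤-reflexive (ℚ.0≤p⇒∣p∣≡p 0≤p)

  ≼⇒≤ : ∀ {p P} → p ≼ P → p ≤ P
  ≼⇒≤ {p} {P} p≼P with ℚ.≤-total 0ℚ p
  ... | inj₁ 0≤p = ≡.subst (_≤ P) (ℚ.0≤p⇒∣p∣≡p 0≤p) p≼P
  ... | inj₂ p≤0 = ℚ.≤-trans p≤0 (≼⇒0≤ p≼P)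

  ≼-+ : ∀ {p q P Q} → p ≼ P → q ≼ Q → p + q ≼ P + Q
  ≼-+ {p} {q} p≼P q≼Q = ℚ.≤-trans (ℚ.∣p+q∣≤∣p∣+∣q∣ p q) (ℚ.+-mono-≤ p≼P q≼Q)

  ≼-neg : ∀ {p P} → p ≼ P → - p ≼ P
  ≼-neg {p} {P} = ≡.subst (_≤ P) (≡.sym (ℚ.∣-p∣≡∣p∣ p))

  ≼-* : ∀ {p q P Q} → p ≼ P → q ≼ Q → p * q ≼ P * Q
  ≼-* {p} {q} {P} {Q} p≼P q≼Q = ≡.subst (_≤ P * Q) (≡.sym (ℚ.∣p*q∣≡∣p∣*∣q∣ p q))
    (*-mono-≤ (ℚ.0≤∣p∣ p) (≼⇒0≤ q≼Q) p≼P q≼Q)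

  ≼-^ : ∀ {p P} n → p ≼ P → p ^ n ≼ P ^ n
  ≼-^ zero    p≼P = ℚ.≤-refl
  ≼-^ (suc n) p≼P = ≼-* p≼P (≼-^ n p≼P)

  ≼-partialSum : ∀ {a A} → (∀ i → a i ≼ A i) → ∀ n →
                 partialSum rawSemiring a n ≼ partialSum rawSemiring A n
  ≼-partialSum a≼A zero    = ℚ.≤-refl
  ≼-partialSum a≼A (suc n) = ≼-+ (a≼A 0) (≼-partialSum (λ i → a≼A (suc i)) n)

  ≼-trinomial : ∀ {t τ x ρ} → t ≼ τ → x ≼ ρ → trinomial t x ≼ trinomial τ ρ
  ≼-trinomial t≼τ x≼ρ = ≼-+ (≼-+ {1ℚ} ℚ.≤-refl (≼-* t≼τ x≼ρ)) (≼-* x≼ρ x≼ρ)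

  ≼-stern : ∀ {t τ} → t ≼ τ → ∀ n → sternℚ t n ≼ sternℚ τ n
  ≼-stern {t} {τ} t≼τ = stern-induction (λ n → sternℚ t n ≼ sternℚ τ n) ℚ.≤-refl
    (≡.subst₂ _≼_ (≡.sym (one-value t)) (≡.sym (one-value τ)) ℚ.≤-refl)
    (λ n ≼ₙ → ≡.subst₂ _≼_ (≡.sym (even-value t n)) (≡.sym (even-value τ n)) (≼-* t≼τ ≼ₙ))
    (λ n ≼ₙ ≼ₙ₊₁ → ≡.subst₂ _≼_ (≡.sym (odd-value t n)) (≡.sym (odd-value τ n)) (≼-+ ≼ₙ ≼ₙ₊₁))
    where open module S t = IsSternSequence (sternℚ-isStern t)

  -- The recursion uses only sums and products; the description as a difference of product and
  -- truncation would give no such comparison.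
  ≼-excess : ∀ {t τ x ρ} → t ≼ τ → x ≼ ρ → ∀ k →
             excess t (sternℚ t) x k ≼ excess τ (sternℚ τ) ρ k
  ≼-excess t≼τ x≼ρ zero    = ℚ.≤-refl
  ≼-excess t≼τ x≼ρ (suc k) =
    ≼-+ (≼-* (≼-trinomial t≼τ x≼ρ) (≼-excess t≼τ (≼-* x≼ρ x≼ρ) k)) (≼-stern t≼τ (2 ℕ.^ k))

  ^≤1 : ∀ {r} n → 0ℚ ≤ r → r ≤ 1ℚ → r ^ n ≤ 1ℚ
  ^≤1     zero    0≤r r≤1 = ℚ.≤-refl
  ^≤1 {r} (suc n) 0≤r r≤1 = *-mono-≤ 0≤r 0≤1 r≤1 (^≤1 n 0≤r r≤1)

  ^-antimono-≤ : ∀ {r m n} → 0ℚ ≤ r → r ≤ 1ℚ → m ℕ.≤ n → r ^ n ≤ r ^ m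
  ^-antimono-≤ {n = n} 0≤r r≤1 z≤n       = ^≤1 n 0≤r r≤1
  ^-antimono-≤ {r}     0≤r r≤1 (s≤s m≤n) = ≤-*ˡ r 0≤r (^-antimono-≤ 0≤r r≤1 m≤n)

  natℚ : ℕ → ℚ
  natℚ n = (ℤ.+ n) ℚ./ 1

  natℚ-suc : ∀ n → natℚ (suc n) ≡ 1ℚ + natℚ n
  natℚ-suc n = /1-+ 1ℤ (ℤ.+ n)

  0≤natℚ : ∀ n → 0ℚ ≤ natℚ n
  0≤natℚ zero    = ℚ.≤-refl
  0≤natℚ (suc n) = ≡.subst (0ℚ ≤_) (≡.sym (natℚ-suc n)) (ℚ.+-mono-≤ 0≤1 (0≤natℚ n))

  archimedean : ∀ p → 0ℚ < p → ∃ λ n → 1ℚ ≤ natℚ n * p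
  archimedean p@(ℚ.mkℚ (ℤ.+ zero) _ _)      (ℚ.*<* (ℤ.+<+ ()))
  -- The denominator serves: its product with p is the numerator, a positive integer.
  archimedean p@(ℚ.mkℚ (ℤ.+ suc k) d-1 _) _ = suc d-1 , ℚ.toℚᵘ-cancel-≤
    (ℚᵘ.≤-respʳ-≃
      (ℚᵘ.≃-sym (ℚᵘ.≃-trans (ℚ.toℚᵘ-homo-* (natℚ (suc d-1)) p)
        (ℚᵘ.*-congʳ (ℚ.toℚᵘ-fromℚᵘ (ℚᵘ.mkℚᵘ (ℤ.+ suc d-1) 0)))))
      (ℚᵘ.*≤* (ℤ.+≤+ bound)))
    where
    bound : 1 ℕ.* suc (d-1 ℕ.+ 0) ℕ.≤ suc d-1 ℕ.* suc k ℕ.* 1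
    bound = ≡.subst₂ ℕ._≤_
      (≡.sym (≡.trans (ℕ.*-identityˡ _) (≡.cong suc (ℕ.+-identityʳ d-1))))
      (≡.sym (ℕ.*-identityʳ (suc d-1 ℕ.* suc k))) (ℕ.m≤m*n (suc d-1) (suc k))
  archimedean (ℚ.mkℚ (ℤ.-[1+ _ ]) _ _) (ℚ.*<* ())

  -- A division-free variant of Bernoulli's inequality, valid at r = 0 too. The induction step is a
  -- convex combination: r times the previous instance plus (1 - r) times a power of r, each bounded
  -- by 1.
  bernoulli : ∀ {r} n → 0ℚ ≤ r → r ≤ 1ℚ → r ^ n * (1ℚ + natℚ n * (1ℚ - r)) ≤ 1ℚ
  bernoulli {r} zero    0≤r r≤1 = ℚ.≤-reflexive (≡.trans (ℚ.*-identityˡ _)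
    (≡.trans (≡.cong (1ℚ +_) (ℚ.*-zeroˡ (1ℚ - r))) (ℚ.+-identityʳ 1ℚ)))
  bernoulli {r} (suc n) 0≤r r≤1 = begin
    r * r ^ n * (1ℚ + natℚ (suc n) * (1ℚ - r))
      ≡⟨ ≡.cong (λ k → r * r ^ n * (1ℚ + k * (1ℚ - r))) (natℚ-suc n) ⟩
    r * r ^ n * (1ℚ + (1ℚ + natℚ n) * (1ℚ - r))
      ≡⟨ solve 3 (λ r p k → r :* p :* (con 1ℚ :+ (con 1ℚ :+ k) :* (con 1ℚ :- r)) :=
           r :* (p :* (con 1ℚ :+ k :* (con 1ℚ :- r))) :+ (con 1ℚ :- r) :* (r :* p))
           ≡.refl r (r ^ n) (natℚ n) ⟩
    r * (r ^ n * (1ℚ + natℚ n * (1ℚ - r))) + (1ℚ - r) * r ^ suc n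
      ≤⟨ ℚ.+-mono-≤ (≤-*ˡ r 0≤r (bernoulli n 0≤r r≤1))
           (≤-*ˡ (1ℚ - r) (0≤1-r r≤1) (^≤1 (suc n) 0≤r r≤1)) ⟩
    r * 1ℚ + (1ℚ - r) * 1ℚ
      ≡⟨ solve 1 (λ r → r :* con 1ℚ :+ (con 1ℚ :- r) :* con 1ℚ := con 1ℚ) ≡.refl r ⟩
    1ℚ ∎
    where
    0≤1-r : r ≤ 1ℚ → 0ℚ ≤ 1ℚ - r
    0≤1-r r≤1 = ≡.subst (_≤ 1ℚ - r) (ℚ.+-inverseʳ r) (ℚ.+-monoˡ-≤ (- r) r≤1)

  p<q⇒0<q-p : ∀ {p q} → p < q → 0ℚ < q - p
  p<q⇒0<q-p {p} {q} p<q = ≡.subst (_< q - p) (ℚ.+-inverseʳ p) (ℚ.+-monoˡ-< (- p) p<q)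

  0<* : ∀ {a b} → 0ℚ < a → 0ℚ < b → 0ℚ < a * b
  0<* {a} {b} 0<a 0<b = ≡.subst (_< a * b) (ℚ.*-zeroʳ a) (ℚ.*-monoʳ-<-pos a {{ℚ.positive 0<a}} 0<b)

  power-small : ∀ {r} → 0ℚ ≤ r → r < 1ℚ → ∀ ε → 0ℚ < ε → ∃ λ n → r ^ n ≤ ε
  power-small {r} 0≤r r<1 ε 0<ε with archimedean ((1ℚ - r) * ε) (0<* (p<q⇒0<q-p r<1) 0<ε)
  ... | n , 1≤n[1-r]ε = n , ℚ.*-cancelʳ-≤-pos (1ℚ + s) {{1+s-pos}} (begin
    r ^ n * (1ℚ + s)                 ≤⟨ bernoulli n 0≤r (ℚ.<⇒≤ r<1) ⟩
    1ℚ                               ≤⟨ 1≤n[1-r]ε ⟩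
    natℚ n * ((1ℚ - r) * ε)          ≤⟨ ≤-+ʳ (ℚ.<⇒≤ 0<ε) ⟩
    natℚ n * ((1ℚ - r) * ε) + ε      ≡⟨ solve 3 (λ n u ε → n :* (u :* ε) :+ ε := ε :* (con 1ℚ :+ n :* u))
                                          ≡.refl (natℚ n) (1ℚ - r) ε ⟩
    ε * (1ℚ + s)                     ∎)
    where
    s : ℚ
    s = natℚ n * (1ℚ - r)
    1+s-pos : ℚ.Positive (1ℚ + s)
    1+s-pos = ℚ.positive (ℚ.+-mono-<-≤ (ℚ.positive⁻¹ 1ℚ) (0≤* (0≤natℚ n) (ℚ.<⇒≤ (p<q⇒0<q-p r<1))))

  quotient : ∀ C ε → 0ℚ < C → 0ℚ < ε → ∃ λ δ → 0ℚ < δ × C * δ ≡ ε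
  quotient C ε 0<C 0<ε = i * ε , 0<* (ℚ.positive⁻¹ i {{ℚ.1/pos⇒pos C}}) 0<ε ,
    ≡.trans (≡.sym (ℚ.*-assoc C i ε)) (≡.trans (≡.cong (_* ε) (ℚ.*-inverseʳ C)) (ℚ.*-identityˡ ε))
    where
    instance
      C-pos : ℚ.Positive C
      C-pos = ℚ.positive 0<C
      C-nonZero : ℚ.NonZero C
      C-nonZero = ℚ.pos⇒nonZero C
    i : ℚ
    i = ℚ.1/ C

  power-small-scaled : ∀ {r} → 0ℚ ≤ r → r < 1ℚ → ∀ C ε → 0ℚ < C → 0ℚ < ε → ∃ λ n → C * r ^ n ≤ ε
  power-small-scaled {r} 0≤r r<1 C ε 0<C 0<ε =
    let δ , 0<δ , Cδ≡ε = quotient C ε 0<C 0<ε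
        n , rⁿ≤δ = power-small 0≤r r<1 δ 0<δ
    in n , ℚ.≤-trans (≤-*ˡ C (ℚ.<⇒≤ 0<C) rⁿ≤δ) (ℚ.≤-reflexive Cδ≡ε)

-- Uniform estimates for products and truncations.

module Estimates where
  open import Data.Rational.Base using (_+_; _*_; _-_; -_; ∣_∣; _≤_; _<_)
  open ℚ.≤-Reasoning
  open +-*-Solver using (solve; _:=_; _:+_; _:*_; _:-_; :-_; con)
  open RationalBounds
  open CommutativeSemiringExp ℚ-semiring using (^-distrib-*)

  -- For ∣t∣ ≤ τ and ∣y∣ ≤ q ≤ 1 one copy of (1 + τ)q bounds the deviation ∣ty + y²∣ of the first
  -- factor from 1; the second copy pays for all later factors.
  smallness : ℚ → ℚ → ℚ
  smallness τ q = (1ℚ + τ) * q + (1ℚ + τ) * q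

  q≤smallness : ∀ {τ q} → 0ℚ ≤ τ → 0ℚ ≤ q → q ≤ (1ℚ + τ) * q
  q≤smallness {τ} {q} 0≤τ 0≤q = ≡.subst (_≤ (1ℚ + τ) * q) (ℚ.*-identityˡ q)
    (*-mono-≤ 0≤1 0≤q (≤-+ʳ 0≤τ) ℚ.≤-refl)

  -- Let u = (1 + τ)q and d = 2u. Squaring the variable turns the bound d into dq, so the product
  -- deviates from 1 by at most (1 + u)dq + u. As u ≤ 1, (1 + u)d ≤ 2d ≤ 1, and q ≤ u; hence this is
  -- at most 2u = d again, whatever k is.
  productUpTo-near-1 : ∀ {t τ} → t ≼ τ → ∀ k {y q} → y ≼ q → smallness τ q + smallness τ q ≤ 1ℚ →
                       productUpTo t y k - 1ℚ ≼ smallness τ q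
  productUpTo-near-1 {t} {τ} t≼τ zero {y} {q} y≼q _ = ℚ.+-mono-≤ 0≤u 0≤u
    where
    0≤u : 0ℚ ≤ (1ℚ + τ) * q
    0≤u = ℚ.≤-trans (≼⇒0≤ y≼q) (q≤smallness (≼⇒0≤ t≼τ) (≼⇒0≤ y≼q))
  productUpTo-near-1 {t} {τ} t≼τ (suc k) {y} {q} y≼q 2d≤1 = begin
    ∣ (1ℚ + t * y + y * y) * Q - 1ℚ ∣
      ≡⟨ ≡.cong ∣_∣ (solve 3 (λ t y Q → (con 1ℚ :+ t :* y :+ y :* y) :* Q :- con 1ℚ :=
           (con 1ℚ :+ (t :* y :+ y :* y)) :* (Q :- con 1ℚ) :+ (t :* y :+ y :* y))
           ≡.refl t y Q) ⟩
    ∣ (1ℚ + (t * y + y * y)) * (Q - 1ℚ) + (t * y + y * y) ∣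
      ≤⟨ ≼-+ (≼-* (≼-+ {1ℚ} ℚ.≤-refl f-1≼u) Q-1≼dq) f-1≼u ⟩
    (1ℚ + u) * (d * q) + u
      ≤⟨ ℚ.+-monoˡ-≤ u (begin
           (1ℚ + u) * (d * q)  ≡⟨ solve 3 (λ u d q → (con 1ℚ :+ u) :* (d :* q) := (d :+ u :* d) :* q)
                                    ≡.refl u d q ⟩
           (d + u * d) * q     ≤⟨ *-mono-≤ (ℚ.+-mono-≤ 0≤d (0≤* 0≤u 0≤d)) 0≤u
                                    (ℚ.≤-trans (ℚ.+-monoʳ-≤ d u*d≤d) 2d≤1)
                                    (q≤smallness 0≤τ 0≤q) ⟩
           1ℚ * u              ≡⟨ ℚ.*-identityˡ u ⟩
           u                   ∎) ⟩
    d ∎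
    where
    Q u d : ℚ
    Q = productUpTo t (y * y) k
    u = (1ℚ + τ) * q
    d = smallness τ q
    0≤τ : 0ℚ ≤ τ
    0≤τ = ≼⇒0≤ t≼τ
    0≤q : 0ℚ ≤ q
    0≤q = ≼⇒0≤ y≼q
    0≤u : 0ℚ ≤ u
    0≤u = ℚ.≤-trans 0≤q (q≤smallness 0≤τ 0≤q)
    0≤d : 0ℚ ≤ d
    0≤d = ℚ.+-mono-≤ 0≤u 0≤u
    u≤1 : u ≤ 1ℚ
    u≤1 = ℚ.≤-trans (≤-+ʳ 0≤u) (ℚ.≤-trans (≤-+ʳ 0≤d) 2d≤1)
    q≤1 : q ≤ 1ℚ
    q≤1 = ℚ.≤-trans (q≤smallness 0≤τ 0≤q) u≤1
    u*d≤d : u * d ≤ d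
    u*d≤d = ≡.subst (u * d ≤_) (ℚ.*-identityˡ d) (*-mono-≤ 0≤u 0≤d u≤1 ℚ.≤-refl)
    d*q≤d : d * q ≤ d
    d*q≤d = ≡.subst (d * q ≤_) (ℚ.*-identityʳ d) (≤-*ˡ d 0≤d q≤1)
    dq : smallness τ (q * q) ≡ d * q
    dq = solve 2 (λ τ q → (con 1ℚ :+ τ) :* (q :* q) :+ (con 1ℚ :+ τ) :* (q :* q) :=
           ((con 1ℚ :+ τ) :* q :+ (con 1ℚ :+ τ) :* q) :* q) ≡.refl τ q
    Q-1≼dq : Q - 1ℚ ≼ d * q
    Q-1≼dq = ≡.subst (Q - 1ℚ ≼_) dq (productUpTo-near-1 t≼τ k (≼-* y≼q y≼q)
      (≡.subst (λ e → e + e ≤ 1ℚ) (≡.sym dq) (ℚ.≤-trans (ℚ.+-mono-≤ d*q≤d d*q≤d) 2d≤1)))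
    f-1≼u : t * y + y * y ≼ u
    f-1≼u = begin
      ∣ t * y + y * y ∣  ≤⟨ ≼-+ (≼-* t≼τ y≼q) (≼-* y≼q y≼q) ⟩
      τ * q + q * q      ≤⟨ ℚ.+-monoʳ-≤ (τ * q) (≤-*ˡ q 0≤q q≤1) ⟩
      τ * q + q * 1ℚ     ≡⟨ solve 2 (λ τ q → τ :* q :+ q :* con 1ℚ := (con 1ℚ :+ τ) :* q) ≡.refl τ q ⟩
      u                  ∎

  -- After m squarings the variable is small enough for `productUpTo-near-1`; the m leading factors
  -- only enlarge the constant.
  productUpTo-bounded : ∀ {τ} → 0ℚ ≤ τ → ∀ m {ρ} → 0ℚ ≤ ρ →
    smallness τ (ρ ^ (2 ℕ.^ m)) + smallness τ (ρ ^ (2 ℕ.^ m)) ≤ 1ℚ →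
    ∃ λ C → 0ℚ < C × (∀ k → productUpTo τ ρ k ≤ C)
  productUpTo-bounded {τ} 0≤τ zero {ρ} 0≤ρ small = 1ℚ + d , 0<1+d , λ k → begin
    productUpTo τ ρ k                 ≡⟨ solve 1 (λ Q → Q := con 1ℚ :+ (Q :- con 1ℚ)) ≡.refl _ ⟩
    1ℚ + (productUpTo τ ρ k - 1ℚ)     ≤⟨ ℚ.+-monoʳ-≤ 1ℚ
                                           (≼⇒≤ (productUpTo-near-1 (0≤⇒≼ 0≤τ) k (0≤⇒≼ 0≤ρ) small′)) ⟩
    1ℚ + d                            ∎
    where
    d : ℚ
    d = smallness τ ρ
    small′ : d + d ≤ 1ℚ
    small′ = ≡.subst (λ q → smallness τ q + smallness τ q ≤ 1ℚ) (ℚ.*-identityʳ ρ) small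
    0<1+d : 0ℚ < 1ℚ + d
    0<1+d = ℚ.+-mono-<-≤ (ℚ.positive⁻¹ 1ℚ)
      (≼⇒0≤ {0ℚ} (productUpTo-near-1 (0≤⇒≼ 0≤τ) 0 (0≤⇒≼ 0≤ρ) small′))
  productUpTo-bounded {τ} 0≤τ (suc m) {ρ} 0≤ρ small =
    let C , 0<C , Q≤C = productUpTo-bounded 0≤τ m (0≤* 0≤ρ 0≤ρ)
          (≡.subst (λ q → smallness τ q + smallness τ q ≤ 1ℚ)
            (≡.trans (even-power ρ (2 ℕ.^ m)) (≡.sym (^-distrib-* ρ ρ (2 ℕ.^ m)))) small)
    -- The summand 1 covers the empty product at k = 0 and keeps the constant positive.
    in 1ℚ + f * C , ℚ.+-mono-<-≤ (ℚ.positive⁻¹ 1ℚ) (0≤* 0≤f (ℚ.<⇒≤ 0<C)) ,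
       λ { zero    → ≤-+ʳ (0≤* 0≤f (ℚ.<⇒≤ 0<C))
         ; (suc k) → ℚ.≤-trans (≤-*ˡ f 0≤f (Q≤C k))
             (≡.subst (_≤ 1ℚ + f * C) (ℚ.+-identityˡ (f * C)) (ℚ.+-monoˡ-≤ (f * C) 0≤1)) }
    where
    f : ℚ
    f = trinomial τ ρ
    0≤f : 0ℚ ≤ f
    0≤f = ≼⇒0≤ (≼-trinomial (0≤⇒≼ 0≤τ) (0≤⇒≼ 0≤ρ))

  smallness-eventually : ∀ {τ ρ} → 0ℚ ≤ τ → 0ℚ ≤ ρ → ρ < 1ℚ →
    ∃ λ m → smallness τ (ρ ^ (2 ℕ.^ m)) + smallness τ (ρ ^ (2 ℕ.^ m)) ≤ 1ℚ
  smallness-eventually {τ} {ρ} 0≤τ 0≤ρ ρ<1 =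
    -- Twice the smallness is 4(1 + τ) times the power, and controlling ρᵐ is enough because m < 2ᵐ.
    let m , small = power-small-scaled 0≤ρ ρ<1 (c + c + (c + c)) 1ℚ
                      (ℚ.+-mono-< (ℚ.+-mono-< 0<c 0<c) (ℚ.+-mono-< 0<c 0<c)) (ℚ.positive⁻¹ 1ℚ)
    in m , (begin
      smallness τ (ρ ^ (2 ℕ.^ m)) + smallness τ (ρ ^ (2 ℕ.^ m))
        ≡⟨ solve 2 (λ c q → (c :* q :+ c :* q) :+ (c :* q :+ c :* q) := (c :+ c :+ (c :+ c)) :* q)
             ≡.refl c (ρ ^ (2 ℕ.^ m)) ⟩
      (c + c + (c + c)) * ρ ^ (2 ℕ.^ m)
        ≤⟨ ≤-*ˡ (c + c + (c + c)) (ℚ.+-mono-≤ (ℚ.+-mono-≤ 0≤c 0≤c) (ℚ.+-mono-≤ 0≤c 0≤c))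
             (^-antimono-≤ 0≤ρ (ℚ.<⇒≤ ρ<1) (ℕ.<⇒≤ (n<2^n m))) ⟩
      (c + c + (c + c)) * ρ ^ m
        ≤⟨ small ⟩
      1ℚ ∎)
    where
    c : ℚ
    c = 1ℚ + τ
    0<c : 0ℚ < c
    0<c = ℚ.+-mono-<-≤ (ℚ.positive⁻¹ 1ℚ) 0≤τ
    0≤c : 0ℚ ≤ c
    0≤c = ℚ.<⇒≤ 0<c

  -- Halving the exponent in the majorant (∣x∣ ≤ ρ²) leaves a spare factor ρⁿ in each term of
  -- degree n, which bounds the tails by ρᴹ without any growth estimate for the coefficients.
  module _ {τ ρ C} (0≤τ : 0ℚ ≤ τ) (0≤ρ : 0ℚ ≤ ρ) (ρ≤1 : ρ ≤ 1ℚ)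
           (Q≤C : ∀ k → productUpTo τ ρ k ≤ C) where

    term : ℕ → ℚ
    term n = sternℚ τ (suc n) * ρ ^ n

    0≤term : ∀ n → 0ℚ ≤ term n
    0≤term n = 0≤* (≼⇒0≤ (≼-stern (0≤⇒≼ 0≤τ) (suc n))) (0≤^ n 0≤ρ)

    0≤sum : ∀ m n → 0ℚ ≤ partialSum rawSemiring (λ i → term (m ℕ.+ i)) n
    0≤sum m n = ≼⇒0≤ (≼-partialSum (λ i → 0≤⇒≼ (0≤term (m ℕ.+ i))) n)

    0≤excess : ∀ k → 0ℚ ≤ excess τ (sternℚ τ) ρ k
    0≤excess k = ≼⇒0≤ (≼-excess (0≤⇒≼ 0≤τ) (0≤⇒≼ 0≤ρ) k)

    truncation+excess≤C : ∀ k →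
      truncation (sternℚ τ) ρ (2 ℕ.^ k) + ρ ^ (2 ℕ.^ k) * excess τ (sternℚ τ) ρ k ≤ C
    truncation+excess≤C k = ℚ.≤-trans
      (ℚ.≤-reflexive (truncation+excess (sternℚ-isStern τ) ρ k)) (Q≤C k)

    -- All terms are nonnegative, so extending the sum to length 2ⁿ and adding the excess only
    -- increases it; the result is a full product.
    truncation≤C : ∀ n → truncation (sternℚ τ) ρ n ≤ C
    truncation≤C n = begin
      truncation (sternℚ τ) ρ n
        ≤⟨ ≤-+ʳ (0≤sum n (2 ℕ.^ n ℕ.∸ n)) ⟩
      truncation (sternℚ τ) ρ n + partialSum rawSemiring (λ i → term (n ℕ.+ i)) (2 ℕ.^ n ℕ.∸ n)
        ≡⟨ partialSum-++ term n (2 ℕ.^ n ℕ.∸ n) ⟨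
      truncation (sternℚ τ) ρ (n ℕ.+ (2 ℕ.^ n ℕ.∸ n))
        ≡⟨ ≡.cong (truncation (sternℚ τ) ρ) (ℕ.m+[n∸m]≡n (ℕ.<⇒≤ (n<2^n n))) ⟩
      truncation (sternℚ τ) ρ (2 ℕ.^ n)
        ≤⟨ ≤-+ʳ (0≤* (0≤^ (2 ℕ.^ n) 0≤ρ) (0≤excess n)) ⟩
      truncation (sternℚ τ) ρ (2 ℕ.^ n) + ρ ^ (2 ℕ.^ n) * excess τ (sternℚ τ) ρ n
        ≤⟨ truncation+excess≤C n ⟩
      C ∎

    excess≤C : ∀ k → ρ ^ (2 ℕ.^ k) * excess τ (sternℚ τ) ρ k ≤ C
    excess≤C k = ℚ.≤-trans
      (≡.subst (_≤ T + E) (ℚ.+-identityˡ E) (ℚ.+-monoˡ-≤ E (0≤sum 0 (2 ℕ.^ k))))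
      (truncation+excess≤C k)
      where
      T E : ℚ
      T = truncation (sternℚ τ) ρ (2 ℕ.^ k)
      E = ρ ^ (2 ℕ.^ k) * excess τ (sternℚ τ) ρ k

    module _ {t x} (t≼τ : t ≼ τ) (x≼ρ² : x ≼ ρ * ρ) (M : ℕ) where

      x≼ρ : x ≼ ρ
      x≼ρ = ℚ.≤-trans x≼ρ² (≡.subst (ρ * ρ ≤_) (ℚ.*-identityʳ ρ) (≤-*ˡ ρ 0≤ρ ρ≤1))

      truncation-tail : ∀ N → M ℕ.≤ N →
        truncation (sternℚ t) x N - truncation (sternℚ t) x M ≼ ρ ^ M * C
      truncation-tail N M≤N = begin
        ∣ truncation (sternℚ t) x N - T ∣
          ≡⟨ ≡.cong (λ n → ∣ truncation (sternℚ t) x n - T ∣) (ℕ.m+[n∸m]≡n M≤N) ⟨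
        ∣ truncation (sternℚ t) x (M ℕ.+ j) - T ∣
          ≡⟨ ≡.cong (λ s → ∣ s - T ∣) (partialSum-++ a M j) ⟩
        ∣ T + partialSum rawSemiring (λ i → a (M ℕ.+ i)) j - T ∣
          ≡⟨ ≡.cong ∣_∣ (solve 2 (λ T s → T :+ s :- T := s) ≡.refl T _) ⟩
        ∣ partialSum rawSemiring (λ i → a (M ℕ.+ i)) j ∣
          ≤⟨ ≼-partialSum a≼ j ⟩
        partialSum rawSemiring (λ i → ρ ^ M * term (M ℕ.+ i)) j
          ≡⟨ partialSum-*ˡ (ρ ^ M) (λ i → term (M ℕ.+ i)) j ⟩
        ρ ^ M * partialSum rawSemiring (λ i → term (M ℕ.+ i)) j
          ≤⟨ ≤-*ˡ (ρ ^ M) (0≤^ M 0≤ρ) (begin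
               S                                        ≡⟨ ℚ.+-identityˡ S ⟨
               0ℚ + S                                   ≤⟨ ℚ.+-monoˡ-≤ S (0≤sum 0 M) ⟩
               truncation (sternℚ τ) ρ M + S            ≡⟨ partialSum-++ term M j ⟨
               truncation (sternℚ τ) ρ (M ℕ.+ j)        ≤⟨ truncation≤C (M ℕ.+ j) ⟩
               C                                        ∎) ⟩
        ρ ^ M * C ∎
        where
        j : ℕ
        j = N ℕ.∸ M
        T S : ℚ
        T = truncation (sternℚ t) x M
        S = partialSum rawSemiring (λ i → term (M ℕ.+ i)) j
        a : ℕ → ℚ
        a n = sternℚ t (suc n) * x ^ n
        a≼ : ∀ i → a (M ℕ.+ i) ≼ ρ ^ M * term (M ℕ.+ i)
        a≼ i = begin
          ∣ a n ∣                                 ≤⟨ ≼-* (≼-stern t≼τ (suc n)) (≼-^ n x≼ρ²) ⟩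
          sternℚ τ (suc n) * (ρ * ρ) ^ n          ≡⟨ ≡.cong (sternℚ τ (suc n) *_) (^-distrib-* ρ ρ n) ⟩
          sternℚ τ (suc n) * (ρ ^ n * ρ ^ n)      ≡⟨ solve 2 (λ b p → b :* (p :* p) := p :* (b :* p))
                                                       ≡.refl (sternℚ τ (suc n)) (ρ ^ n) ⟩
          ρ ^ n * term n                          ≤⟨ *-mono-≤ (0≤^ n 0≤ρ) (0≤term n)
                                                       (^-antimono-≤ 0≤ρ ρ≤1 (ℕ.m≤m+n M i)) ℚ.≤-refl ⟩
          ρ ^ M * term n                          ∎
          where
          n : ℕ
          n = M ℕ.+ i

      excess-tail : ∀ k → M ℕ.≤ k → x ^ (2 ℕ.^ k) * excess t (sternℚ t) x k ≼ ρ ^ M * C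
      excess-tail k M≤k = begin
        ∣ x ^ n * excess t (sternℚ t) x k ∣
          ≤⟨ ≼-* (≼-^ n x≼ρ²) (≼-excess t≼τ x≼ρ k) ⟩
        (ρ * ρ) ^ n * E
          ≡⟨ ≡.trans (≡.cong (_* E) (^-distrib-* ρ ρ n)) (ℚ.*-assoc (ρ ^ n) (ρ ^ n) E) ⟩
        ρ ^ n * (ρ ^ n * E)
          ≤⟨ *-mono-≤ (0≤^ n 0≤ρ) (ℚ.≤-trans (0≤* (0≤^ n 0≤ρ) (0≤excess k)) (excess≤C k))
               (^-antimono-≤ 0≤ρ ρ≤1 (ℕ.≤-trans M≤k (ℕ.<⇒≤ (n<2^n k)))) (excess≤C k) ⟩
        ρ ^ M * C ∎
        where
        n : ℕ
        n = 2 ℕ.^ k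
        E : ℚ
        E = excess τ (sternℚ τ) ρ k

      product-truncation-close : ∀ k N → M ℕ.≤ k → M ℕ.≤ N →
        productUpTo t x k - truncation (sternℚ t) x N ≼ (C + C + C) * ρ ^ M
      product-truncation-close k N M≤k M≤N = begin
        ∣ productUpTo t x k - T N ∣
          ≡⟨ ≡.cong (λ Q → ∣ Q - T N ∣) (truncation+excess (sternℚ-isStern t) x k) ⟨
        ∣ T (2 ℕ.^ k) + E - T N ∣
          -- 2ᵏ and N may come in either order, so both truncations are compared with the one of
          -- length M. The two tails and the excess cost ρᴹC each.
          ≡⟨ ≡.cong ∣_∣ (solve 4 (λ a E b c → a :+ E :- b := (a :- c) :+ E :+ (:- (b :- c)))
               ≡.refl (T (2 ℕ.^ k)) E (T N) (T M)) ⟩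
        ∣ (T (2 ℕ.^ k) - T M) + E + (- (T N - T M)) ∣
          ≤⟨ ≼-+ (≼-+ (truncation-tail (2 ℕ.^ k) (ℕ.≤-trans M≤k (ℕ.<⇒≤ (n<2^n k)))) (excess-tail k M≤k))
               (≼-neg (truncation-tail N M≤N)) ⟩
        ρ ^ M * C + ρ ^ M * C + ρ ^ M * C
          ≡⟨ solve 2 (λ p C → p :* C :+ p :* C :+ p :* C := (C :+ C :+ C) :* p) ≡.refl (ρ ^ M) C ⟩
        (C + C + C) * ρ ^ M ∎
        where
        T : ℕ → ℚ
        T = truncation (sternℚ t) x
        E : ℚ
        E = x ^ (2 ℕ.^ k) * excess t (sternℚ t) x k

  -- The order of quantifiers is the point: M precedes t and x, so one M serves all sufficiently
  -- late indices of the Cauchy sequences.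
  products-approximate-truncations : ∀ {τ ρ} → 0ℚ ≤ τ → 0ℚ ≤ ρ → ρ < 1ℚ → ∀ ε → 0ℚ < ε →
    ∃ λ M → ∀ {t x} → t ≼ τ → x ≼ ρ * ρ → ∀ k N → M ℕ.≤ k → M ℕ.≤ N →
    productUpTo t x k - truncation (sternℚ t) x N ≼ ε
  products-approximate-truncations 0≤τ 0≤ρ ρ<1 ε 0<ε =
    let m , small = smallness-eventually 0≤τ 0≤ρ ρ<1
        C , 0<C , Q≤C = productUpTo-bounded 0≤τ m 0≤ρ small
        M , 3Cρᴹ≤ε = power-small-scaled 0≤ρ ρ<1 (C + C + C) ε (ℚ.+-mono-< (ℚ.+-mono-< 0<C 0<C) 0<C) 0<ε
    in M , λ t≼τ x≼ρ² k N M≤k M≤N → ℚ.≤-trans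
      (product-truncation-close 0≤τ 0≤ρ (ℚ.<⇒≤ ρ<1) Q≤C t≼τ x≼ρ² M k N M≤k M≤N) 3Cρᴹ≤ε

-- Convergence of the series and the product over the reals.

module RealConvergence where
  open import Data.Rational.Base using (_+_; _*_; _-_; -_; ∣_∣; _≤_; _<_)
  open ℚ.≤-Reasoning
  open +-*-Solver using (solve; _:=_; _:+_; _:*_; _:-_; :-_; con)
  open RationalBounds
  open Estimates

  seq-^ : ∀ x k n → seq (x ^ᵣ k) n ≡ seq x n ^ k
  seq-^ x zero    n = ≡.refl
  seq-^ x (suc k) n = ≡.cong (seq x n *_) (seq-^ x k n)

  seq-partialSum : ∀ a k n → seq (partialSum realRawSemiring a k) n ≡
                   partialSum rawSemiring (λ i → seq (a i) n) k
  seq-partialSum a zero    n = ≡.refl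
  seq-partialSum a (suc k) n = ≡.cong (seq (a 0) n +_) (seq-partialSum (λ i → a (suc i)) k n)

  seq-partialProduct : ∀ a k n → seq (partialProduct realRawSemiring a k) n ≡
                       partialProduct rawSemiring (λ i → seq (a i) n) k
  seq-partialProduct a zero    n = ≡.refl
  seq-partialProduct a (suc k) n = ≡.cong (seq (a 0) n *_) (seq-partialProduct (λ i → a (suc i)) k n)

  seq-eval : ∀ p t n → seq (eval p t) n ≡ evalℚ p (seq t n)
  seq-eval []      t n = ≡.refl
  seq-eval (a ∷ p) t n = ≡.cong (λ v → (a ℚ./ 1) + seq t n * v) (seq-eval p t n)

  seq-factor : ∀ t x k n → seq (factor realRawSemiring t x k) n ≡
               factor rawSemiring (seq t n) (seq x n) k
  seq-factor t x k n = ≡.cong₂ (λ u v → 1ℚ + seq t n * u + v)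
    (seq-^ x (2 ℕ.^ k) n) (seq-^ x (2 ℕ.^ suc k) n)

  seq-tailProduct : ∀ t x m k n →
    seq (partialProduct realRawSemiring (λ i → factor realRawSemiring t x (m ℕ.+ i)) k) n ≡
    productUpTo (seq t n) (seq x n ^ (2 ℕ.^ m)) k
  seq-tailProduct t x m k n = ≡.trans
    (seq-partialProduct (λ i → factor realRawSemiring t x (m ℕ.+ i)) k n)
    (≡.trans (partialProduct-cong (λ i → seq-factor t x (m ℕ.+ i) n) k)
      (partialProduct-factor-shift (seq t n) (seq x n) m k))

  seq-product : ∀ t x k n → seq (partialProduct realRawSemiring (factor realRawSemiring t x) k) n ≡
                productUpTo (seq t n) (seq x n) k
  seq-product t x k n = ≡.trans (seq-tailProduct t x 0 k n)
    (≡.cong (λ y → productUpTo (seq t n) y k) (ℚ.*-identityʳ (seq x n)))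

  -- The lengths differ by one because the term of B_0 = 0 vanishes; the other terms share a factor
  -- x.
  seq-sternSum : ∀ t x k n →
    seq (partialSum realRawSemiring (λ i → eval (stern i) t *ᵣ x ^ᵣ i) (suc k)) n ≡
    seq x n * truncation (sternℚ (seq t n)) (seq x n) k
  seq-sternSum t x k n = begin-equality
    seq (partialSum realRawSemiring (λ i → eval (stern i) t *ᵣ x ^ᵣ i) (suc k)) n
      ≡⟨ seq-partialSum (λ i → eval (stern i) t *ᵣ x ^ᵣ i) (suc k) n ⟩
    partialSum rawSemiring (λ i → seq (eval (stern i) t) n * seq (x ^ᵣ i) n) (suc k)
      ≡⟨ partialSum-cong (λ i → ≡.cong₂ _*_ (seq-eval (stern i) t n) (seq-^ x i n)) (suc k) ⟩
    0ℚ * 1ℚ + partialSum rawSemiring (λ i → b (suc i) * (y * y ^ i)) k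
      ≡⟨ ℚ.+-identityˡ _ ⟩
    partialSum rawSemiring (λ i → b (suc i) * (y * y ^ i)) k
      ≡⟨ partialSum-cong (λ i → solve 3 (λ b y p → b :* (y :* p) := y :* (b :* p))
           ≡.refl (b (suc i)) y (y ^ i)) k ⟩
    partialSum rawSemiring (λ i → y * (b (suc i) * y ^ i)) k
      ≡⟨ partialSum-*ˡ y (λ i → b (suc i) * y ^ i) k ⟩
    y * truncation b y k ∎
    where
    y : ℚ
    y = seq x n
    b : ℕ → ℚ
    b = sternℚ (seq t n)

  half-pos : ∀ {ε} → 0ℚ < ε → 0ℚ < ½ * ε
  half-pos 0<ε = 0<* (ℚ.positive⁻¹ ½) 0<ε

  half+half : ∀ ε → ½ * ε + ½ * ε ≡ ε
  half+half ε = ≡.trans (≡.sym (ℚ.*-distribʳ-+ ε ½ ½)) (ℚ.*-identityˡ ε)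

  ≼-halves : ∀ {p q} ε → p ≼ ½ * ε → q ≼ ½ * ε → p + q ≼ ε
  ≼-halves {p} {q} ε p≼ q≼ = ≡.subst (p + q ≼_) (half+half ε) (≼-+ p≼ q≼)

  half<self : ∀ {ε} → 0ℚ < ε → ½ * ε < ε
  half<self {ε} 0<ε = ≡.subst₂ _<_ (ℚ.+-identityʳ (½ * ε)) (half+half ε)
    (ℚ.+-monoʳ-< (½ * ε) (half-pos 0<ε))

  UniformlyClose : (ℕ → ℝ) → ℝ → Set
  UniformlyClose s L = ∀ ε → 0ℚ < ε → ∃ λ M → ∀ i n → M ℕ.≤ i → M ℕ.≤ n →
                       seq (s i) n - seq L n ≼ ε

  -- Since `_<ᵣ_` demands a uniform gap, half of δ bounds the distance and the other half is the
  -- gap.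
  UniformlyClose⇒TendsTo : ∀ s L → UniformlyClose s L → TendsTo s L
  UniformlyClose⇒TendsTo s L close ε (δ , 0<δ , N , δ≤ε) =
    let M , bound = close (½ * δ) (half-pos 0<δ) in
    M , λ i M≤i → ½ * δ , half-pos 0<δ , M ℕ.⊔ N , λ n M⊔N≤n → begin
      ∣ seq (s i) n - seq L n ∣ + ½ * δ
        ≤⟨ ℚ.+-monoˡ-≤ (½ * δ) (bound i n M≤i (ℕ.m⊔n≤o⇒m≤o M N M⊔N≤n)) ⟩
      ½ * δ + ½ * δ     ≡⟨ half+half δ ⟩
      δ                 ≡⟨ ℚ.+-identityˡ δ ⟨
      0ℚ + δ            ≤⟨ δ≤ε n (ℕ.m⊔n≤o⇒n≤o M N M⊔N≤n) ⟩
      seq ε n           ∎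

  -- The moduli of the individual `s i` are unrelated, so in general the plain diagonal need not be
  -- Cauchy; control uniform in the index n makes it a limit.
  UniformlyCauchy : (ℕ → ℝ) → Set
  UniformlyCauchy s = ∀ ε → 0ℚ < ε → ∃ λ M → ∀ i j n → M ℕ.≤ i → M ℕ.≤ j → M ℕ.≤ n →
                      seq (s i) n - seq (s j) n ≼ ε

  diagonal-cauchy : ∀ s → UniformlyCauchy s → ∀ ε → 0ℚ < ε →
    ∃ λ N → ∀ m n → N ℕ.≤ m → N ℕ.≤ n → ∣ seq (s m) m - seq (s n) n ∣ < ε
  diagonal-cauchy s uniform ε 0<ε =
    -- The two comparisons with the fixed real `s M` cost a quarter of ε each. Half is left for the
    -- variation of `s M`, whose modulus is available only after M is chosen.
    let η = ½ * (½ * ε)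
        0<η = half-pos (half-pos 0<ε)
        M , close = uniform η 0<η
        N , closeₘ = cauchy (s M) (½ * ε) (half-pos 0<ε)
    in M ℕ.⊔ N , λ m n M⊔N≤m M⊔N≤n →
      let M≤m = ℕ.m⊔n≤o⇒m≤o M N M⊔N≤m
          M≤n = ℕ.m⊔n≤o⇒m≤o M N M⊔N≤n
      in begin-strict
      ∣ seq (s m) m - seq (s n) n ∣
        ≡⟨ ≡.cong ∣_∣ (solve 4 (λ a b c d → a :- d := ((a :- b) :+ (c :- d)) :+ (b :- c))
             ≡.refl (seq (s m) m) (seq (s M) m) (seq (s M) n) (seq (s n) n)) ⟩
      ∣ ((seq (s m) m - seq (s M) m) + (seq (s M) n - seq (s n) n)) + (seq (s M) m - seq (s M) n) ∣
        ≤⟨ ℚ.∣p+q∣≤∣p∣+∣q∣ ((seq (s m) m - seq (s M) m) + (seq (s M) n - seq (s n) n)) _ ⟩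
      ∣ (seq (s m) m - seq (s M) m) + (seq (s M) n - seq (s n) n) ∣ + ∣ seq (s M) m - seq (s M) n ∣
        <⟨ ℚ.+-mono-≤-<
             (≼-halves (½ * ε) (close m M m M≤m ℕ.≤-refl M≤m) (close M n n ℕ.≤-refl M≤n M≤n))
             (closeₘ m n (ℕ.m⊔n≤o⇒n≤o M N M⊔N≤m) (ℕ.m⊔n≤o⇒n≤o M N M⊔N≤n)) ⟩
      ½ * ε + ½ * ε
        ≡⟨ half+half ε ⟩
      ε ∎

  diagonal : ∀ s → UniformlyCauchy s → ℝ
  diagonal s uniform = mkℝ (λ n → seq (s n) n) (diagonal-cauchy s uniform)

  diagonal-limit : ∀ s uniform → TendsTo s (diagonal s uniform)
  diagonal-limit s uniform = UniformlyClose⇒TendsTo s (diagonal s uniform) λ ε 0<ε →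
    let M , close = uniform ε 0<ε in M , λ i n M≤i M≤n → close i n n M≤i M≤n M≤n

  eventually-bounded : ∀ x → ∃₂ λ B N → 0ℚ ≤ B × (∀ n → N ℕ.≤ n → seq x n ≼ B)
  eventually-bounded x with cauchy x 1ℚ (ℚ.positive⁻¹ 1ℚ)
  ... | N , close = 1ℚ + ∣ seq x N ∣ , N , ℚ.+-mono-≤ 0≤1 (ℚ.0≤∣p∣ (seq x N)) , λ n N≤n →
    ≡.subst (_≼ 1ℚ + ∣ seq x N ∣) (solve 2 (λ p q → (p :- q) :+ q := p) ≡.refl (seq x n) (seq x N))
      (≼-+ {seq x n - seq x N} {seq x N} (ℚ.<⇒≤ (close n N N≤n ℕ.≤-refl)) ℚ.≤-refl)

  -- ρ = 1 − δ/2 satisfies ρ² ≥ 1 − δ.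
  eventually-below-square : ∀ x → ∣ x ∣ᵣ <ᵣ 1ᵣ →
    ∃₂ λ ρ N → 0ℚ ≤ ρ × ρ < 1ℚ × (∀ n → N ℕ.≤ n → seq x n ≼ ρ * ρ)
  eventually-below-square x (δ , 0<δ , N , ∣x∣+δ≤1) = ρ , N , 0≤ρ , ρ<1 , λ n N≤n → begin
    ∣ seq x n ∣              ≡⟨ solve 2 (λ a δ → a := a :+ δ :- δ) ≡.refl ∣ seq x n ∣ δ ⟩
    ∣ seq x n ∣ + δ - δ      ≤⟨ ℚ.+-monoˡ-≤ (- δ) (∣x∣+δ≤1 n N≤n) ⟩
    1ℚ - δ                   ≤⟨ ≤-+ʳ (0≤* (ℚ.<⇒≤ (half-pos 0<δ)) (ℚ.<⇒≤ (half-pos 0<δ))) ⟩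
    1ℚ - δ + h * h           ≡⟨ ≡.cong (λ d → 1ℚ - d + h * h) (half+half δ) ⟨
    1ℚ - (h + h) + h * h     ≡⟨ solve 1 (λ h → con 1ℚ :- (h :+ h) :+ h :* h :=
                                  (con 1ℚ :- h) :* (con 1ℚ :- h)) ≡.refl h ⟩
    ρ * ρ                    ∎
    where
    h ρ : ℚ
    h = ½ * δ
    ρ = 1ℚ - h
    δ≤1 : δ ≤ 1ℚ
    δ≤1 = begin
      δ                 ≡⟨ ℚ.+-identityˡ δ ⟨
      0ℚ + δ            ≤⟨ ℚ.+-monoˡ-≤ δ (ℚ.0≤∣p∣ (seq x N)) ⟩
      ∣ seq x N ∣ + δ   ≤⟨ ∣x∣+δ≤1 N ℕ.≤-refl ⟩
      1ℚ                ∎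
    0≤ρ : 0ℚ ≤ ρ
    0≤ρ = ≡.subst (_≤ ρ) (ℚ.+-inverseʳ h)
      (ℚ.+-monoˡ-≤ (- h) (ℚ.≤-trans (ℚ.<⇒≤ (half<self 0<δ)) δ≤1))
    ρ<1 : ρ < 1ℚ
    ρ<1 = ≡.subst (ρ <_) (ℚ.+-identityʳ 1ℚ) (ℚ.+-monoʳ-< 1ℚ (ℚ.neg-antimono-< (half-pos 0<δ)))

  module _ {τ ρ} (0≤τ : 0ℚ ≤ τ) (0≤ρ : 0ℚ ≤ ρ) (ρ<1 : ρ < 1ℚ) (t x : ℝ) (N₀ : ℕ)
           (t≼τ : ∀ n → N₀ ℕ.≤ n → seq t n ≼ τ) (x≼ρ² : ∀ n → N₀ ℕ.≤ n → seq x n ≼ ρ * ρ) where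

    ρ≤1 : ρ ≤ 1ℚ
    ρ≤1 = ℚ.<⇒≤ ρ<1

    ρ²≤1 : ρ * ρ ≤ 1ℚ
    ρ²≤1 = *-mono-≤ 0≤ρ 0≤1 ρ≤1 ρ≤1

    tailProduct : ℕ → ℕ → ℝ
    tailProduct m = partialProduct realRawSemiring (λ i → factor realRawSemiring t x (m ℕ.+ i))

    power≼ρ² : ∀ m n → N₀ ℕ.≤ n → seq x n ^ (2 ℕ.^ m) ≼ ρ * ρ
    power≼ρ² m n N₀≤n = begin
      ∣ seq x n ^ (2 ℕ.^ m) ∣  ≤⟨ ≼-^ (2 ℕ.^ m) (x≼ρ² n N₀≤n) ⟩
      (ρ * ρ) ^ (2 ℕ.^ m)      ≤⟨ ^-antimono-≤ (0≤* 0≤ρ 0≤ρ) ρ²≤1 (ℕ.m^n>0 2 m) ⟩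
      ρ * ρ * 1ℚ               ≡⟨ ℚ.*-identityʳ (ρ * ρ) ⟩
      ρ * ρ                    ∎

    -- The tail is a full product at a power of x that is still bounded by ρ², and both partial
    -- products are close to the same truncation there.
    tailProduct-uniform : ∀ m → UniformlyCauchy (tailProduct m)
    tailProduct-uniform m ε 0<ε =
      let M , close = products-approximate-truncations 0≤τ 0≤ρ ρ<1 (½ * ε) (half-pos 0<ε) in
      M ℕ.⊔ N₀ , λ i j n ≤i ≤j ≤n →
      let N₀≤n = ℕ.m⊔n≤o⇒n≤o M N₀ ≤n
          y = seq x n ^ (2 ℕ.^ m)
          T = truncation (sternℚ (seq t n)) y M
          close-to-T k M≤k = close (t≼τ n N₀≤n) (power≼ρ² m n N₀≤n) k M M≤k ℕ.≤-refl
      in begin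
        ∣ seq (tailProduct m i) n - seq (tailProduct m j) n ∣
          ≡⟨ ≡.cong₂ (λ p q → ∣ p - q ∣) (seq-tailProduct t x m i n) (seq-tailProduct t x m j n) ⟩
        ∣ productUpTo (seq t n) y i - productUpTo (seq t n) y j ∣
          ≡⟨ ≡.cong ∣_∣ (solve 3 (λ p q T → p :- q := (p :- T) :+ (:- (q :- T))) ≡.refl
               (productUpTo (seq t n) y i) (productUpTo (seq t n) y j) T) ⟩
        ∣ (productUpTo (seq t n) y i - T) + (- (productUpTo (seq t n) y j - T)) ∣
          ≤⟨ ≼-halves ε (close-to-T i (ℕ.m⊔n≤o⇒m≤o M N₀ ≤i))
               (≼-neg (close-to-T j (ℕ.m⊔n≤o⇒m≤o M N₀ ≤j))) ⟩
        ε ∎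

    tailLimit : ℕ → ℝ
    tailLimit m = diagonal (tailProduct m) (tailProduct-uniform m)

    -- For m from `smallness-eventually` the deviation from 1 is at most 1/2 at every late index,
    -- which leaves 1/2 as the gap above zero.
    tailLimit-nonzero : ∃ λ m → 0ᵣ <ᵣ ∣ tailLimit m ∣ᵣ
    tailLimit-nonzero =
      let m , small = smallness-eventually 0≤τ 0≤ρ ρ<1
          d = smallness τ (ρ ^ (2 ℕ.^ m))
      in m , ½ , ℚ.positive⁻¹ ½ , N₀ , λ n N₀≤n →
      let y = seq x n ^ (2 ℕ.^ m)
          Q = productUpTo (seq t n) y n
          y≼ : y ≼ ρ ^ (2 ℕ.^ m)
          y≼ = ≼-^ (2 ℕ.^ m) (ℚ.≤-trans (x≼ρ² n N₀≤n)
                 (≡.subst (ρ * ρ ≤_) (ℚ.*-identityʳ ρ) (≤-*ˡ ρ 0≤ρ ρ≤1)))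
      in begin
        0ℚ + ½                    ≡⟨⟩
        1ℚ - ½                    ≤⟨ ℚ.+-monoˡ-≤ (- ½) (begin
             1ℚ                   ≡⟨ ≡.cong ∣_∣ (solve 1 (λ Q → con 1ℚ := Q :+ (:- (Q :- con 1ℚ))) ≡.refl Q) ⟩
             ∣ Q + (- (Q - 1ℚ)) ∣ ≤⟨ ≼-+ {Q} ℚ.≤-refl (≼-neg (productUpTo-near-1 (t≼τ n N₀≤n) n y≼ small)) ⟩
             ∣ Q ∣ + d            ≤⟨ ℚ.+-monoʳ-≤ ∣ Q ∣ (d≤½ d small) ⟩
             ∣ Q ∣ + ½            ∎) ⟩
        ∣ Q ∣ + ½ - ½             ≡⟨ solve 1 (λ q → q :+ con ½ :- con ½ := q) ≡.refl ∣ Q ∣ ⟩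
        ∣ Q ∣                     ≡⟨ ≡.cong ∣_∣ (seq-tailProduct t x m n n) ⟨
        ∣ seq (tailLimit m) n ∣   ∎
      where
      d≤½ : ∀ d → d + d ≤ 1ℚ → d ≤ ½
      d≤½ d 2d≤1 = begin
        d               ≡⟨ solve 1 (λ d → d := con ½ :* (d :+ d)) ≡.refl d ⟩
        ½ * (d + d)     ≤⟨ ≤-*ˡ ½ (ℚ.nonNegative⁻¹ ½) 2d≤1 ⟩
        ½ * 1ℚ          ≡⟨⟩
        ½               ∎

    hasProduct : HasProduct (factor realRawSemiring t x) (tailLimit 0)
    hasProduct = diagonal-limit (tailProduct 0) (tailProduct-uniform 0) ,
      let m , nonzero = tailLimit-nonzero in
      m , tailLimit m , diagonal-limit (tailProduct m) (tailProduct-uniform m) , nonzero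

    sternSum : ℕ → ℝ
    sternSum = partialSum realRawSemiring (λ n → eval (stern n) t *ᵣ x ^ᵣ n)

    sternSum-close : UniformlyClose sternSum (x *ᵣ tailLimit 0)
    sternSum-close ε 0<ε =
      let M , close = products-approximate-truncations 0≤τ 0≤ρ ρ<1 ε 0<ε in
      -- One more than M, because a sum of length k + 1 corresponds to a truncation of length k;
      -- this also excludes the empty sum.
      suc M ℕ.⊔ N₀ , λ
        { zero    n ≤i ≤n → contradict (ℕ.m⊔n≤o⇒m≤o (suc M) N₀ ≤i)
        ; (suc k) n ≤i ≤n →
          let N₀≤n = ℕ.m⊔n≤o⇒n≤o (suc M) N₀ ≤n
              M≤n  = ℕ.<⇒≤ (ℕ.m⊔n≤o⇒m≤o (suc M) N₀ ≤n)
              M≤k  = ℕ.≤-pred (ℕ.m⊔n≤o⇒m≤o (suc M) N₀ ≤i)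
              y = seq x n
              T = truncation (sternℚ (seq t n)) y k
              Q = productUpTo (seq t n) y n
          in begin
            ∣ seq (sternSum (suc k)) n - y * seq (tailProduct 0 n) n ∣
              ≡⟨ ≡.cong₂ (λ s p → ∣ s - y * p ∣) (seq-sternSum t x k n) (seq-product t x n n) ⟩
            ∣ y * T - y * Q ∣
              ≡⟨ ≡.cong ∣_∣ (solve 3 (λ y T Q → y :* T :- y :* Q := :- (y :* (Q :- T))) ≡.refl y T Q) ⟩
            ∣ - (y * (Q - T)) ∣
              ≤⟨ ≼-neg (≼-* (ℚ.≤-trans (x≼ρ² n N₀≤n) ρ²≤1)
                   (close (t≼τ n N₀≤n) (x≼ρ² n N₀≤n) n k M≤n M≤k)) ⟩
            1ℚ * ε
              ≡⟨ ℚ.*-identityˡ ε ⟩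
            ε ∎
        }
      where
      contradict : ∀ {a} {A : Set a} {n} → suc n ℕ.≤ 0 → A
      contradict ()

    hasSum : HasSum (λ n → eval (stern n) t *ᵣ x ^ᵣ n) (x *ᵣ tailLimit 0)
    hasSum = UniformlyClose⇒TendsTo sternSum (x *ᵣ tailLimit 0) sternSum-close

  ≃-refl : ∀ x → x ≃ x
  ≃-refl x ε 0<ε = 0 , λ n _ → ≡.subst (_< ε) (≡.cong ∣_∣ (≡.sym (ℚ.+-inverseʳ (seq x n)))) 0<ε

  series-equals-product : ∀ t x → ∣ x ∣ᵣ <ᵣ 1ᵣ → ∃₂ λ S P →
    HasSum (λ n → eval (stern n) t *ᵣ x ^ᵣ n) S × HasProduct (factor realRawSemiring t x) P × S ≃ x *ᵣ P
  series-equals-product t x ∣x∣<1 =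
    let τ , Nₜ , 0≤τ , t≼τ = eventually-bounded t
        ρ , Nₓ , 0≤ρ , ρ<1 , x≼ρ² = eventually-below-square x ∣x∣<1
        N = Nₜ ℕ.⊔ Nₓ
        t≼ n N≤n = t≼τ n (ℕ.m⊔n≤o⇒m≤o Nₜ Nₓ N≤n)
        x≼ n N≤n = x≼ρ² n (ℕ.m⊔n≤o⇒n≤o Nₜ Nₓ N≤n)
        P = tailLimit 0≤τ 0≤ρ ρ<1 t x N t≼ x≼ 0
    -- The sum is taken to be x · P itself, so the equality is reflexivity and its content lies in
    -- `hasSum`.
    in x *ᵣ P , P , hasSum 0≤τ 0≤ρ ρ<1 t x N t≼ x≼ ,
       hasProduct 0≤τ 0≤ρ ρ<1 t x N t≼ x≼ , ≃-refl (x *ᵣ P)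

theorem3p1 : (∃ λ (P : Series) →
    HasProductₛ (factor seriesRawSemiring (constₛ tₚ) xₛ) P ×
    stern ≈ₛ xₛ *ₛ P) ×
    (∀ (t x : ℝ) → ∣ x ∣ᵣ <ᵣ 1ᵣ →
    ∃₂ λ (S P : ℝ) →
    HasSum (λ n → eval (stern n) t *ᵣ x ^ᵣ n) S ×
    HasProduct (factor realRawSemiring t x) P ×
    S ≃ x *ᵣ P)
theorem3p1 =
  ((λ n → stern (suc n)) , FormalIdentity.hasProduct , FormalIdentity.stern-series) ,
  RealConvergence.series-equals-product
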